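{- Let $\mathcal{O}$ be a Dedekind domain and let $\mathcal{F}$ be a finite set of maximal ideals in $\mathcal{O}$. Let $M_i$, $1\leq i\leq l$, be finitely many co-torsion submodules of rank two in $\mathcal{O}^2$ with invariant factor ideals $\mathcal{L}_i \supseteq \mathcal{K}_i$ such that $\mathcal{K}_i+\mathcal{K}_j=\mathcal{O}$ for $1\leq i\neq j\leq l$. Let $\mathcal{I}_i$, $1\leq i\leq l$, be the ideals in $\mathcal{O}$ with $\mathcal{K}_i=\mathcal{L}_i\mathcal{I}_i$. Assume that if a maximal ideal $\mathcal{M}$ satisfies $\mathcal{M} \supseteq \mathcal{K}_i$ for some $1\leq i\leq l$, then $\mathcal{M}\in \mathcal{F}$. For $1\leq i\leq l$, let $[a_i:b_i]\in \mathbb{PF}^1_{\mathcal{I}_i}$ be the projective space invariant element of $M_i$. Let $a,b\in \mathcal{O}$ with $\langle a \rangle +\langle b \rangle=\mathcal{O}$, defining $[a:b]\in \mathbb{PF}^1_{\prod_{i=1}^l\mathcal{I}_i}$, be such that $[a:b]=[a_i:b_i]\in \mathbb{PF}^1_{\mathcal{I}_i}$ for $1\leq i\leq l$. Then: \begin{enumerate} \item The module $\bigcap_{i=1}^{l} M_i$ is a co-torsion module of rank two in $\mathcal{O}^2$. \item The invariant factor ideals of $\bigcap_{i=1}^{l} M_i$ are $\mathcal{L}=\prod_{i=1}^l\mathcal{L}_i\supseteq \mathcal{K}=\prod_{i=1}^l\mathcal{K}_i$. \item The projective space invariant element of $\bigcap_{i=1}^{l} M_i$ is $[a:b]\in \mathbb{PF}^1_{\prod_{i=1}^l\mathcal{I}_i}$.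 \item For any element $t\in \mathcal{L}\setminus\big(\bigcup_{\mathcal{M}\in \mathcal{F}}\mathcal{L}\mathcal{M}\big)$ we have $(ta,tb)\in \bigcap_{i=1}^{l} M_i$. \end{enumerate}
   Context: An $\mathcal{O}$-submodule $M\subseteq \mathcal{O}^2$ is co-torsion if $\mathcal{O}^2/M$ is a torsion $\mathcal{O}$-module. Its rank is the cardinality of a maximal $\mathcal{O}$-linearly independent subset. Projective space: let $(\mathcal{O}^2)^{*}=\{(a,b)\in \mathcal{O}^2\mid \langle a\rangle +\langle b\rangle = \mathcal{O}\}$. For an ideal $\mathcal{I}\subseteq\mathcal{O}$, define the equivalence relation on $(\mathcal{O}^2)^*$ by $(a,b)\sim (c,d)$ iff $ad-bc\in \mathcal{I}$. Then $\mathbb{PF}^1_{\mathcal{I}}=(\mathcal{O}^2)^{*}/\sim$, and the class of $(a,b)$ is denoted $[a:b]$. Invariants of a co-torsion submodule $M\subseteq\mathcal{O}^2$: there are finitely many distinct maximal ideals $\mathcal{M}_1,\dots,\mathcal{M}_r$ of $\mathcal{O}$ and integers $0\le n_j\le k_j\ne 0$, $1\le j\le r$, with $\mathcal{O}^2/M\cong\bigoplus_{j=1}^r\big(\mathcal{O}/\mathcal{M}_j^{n_j}\oplus\mathcal{O}/\mathcal{M}_j^{k_j}\big)$ ($r=0$ if $M=\mathcal{O}^2$). The invariant factor ideals of $M$ are $\mathcal{L}=\prod_{j=1}^r\mathcal{M}_j^{n_j}\supseteq\mathcal{K}=\prod_{j=1}^r\mathcal{M}_j^{k_j}$, so $\mathcal{O}^2/M\cong\mathcal{O}/\mathcal{L}\oplus\mathcal{O}/\mathcal{K}$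 (empty products are $\mathcal{O}$). Put $\mathcal{I}=\prod_{j=1}^r\mathcal{M}_j^{k_j-n_j}$, so $\mathcal{K}=\mathcal{L}\mathcal{I}$. The projective space invariant element of $M$ is the class $[a:b]\in\mathbb{PF}^1_{\mathcal{I}}$ of any $(a,b)\in(\mathcal{O}^2)^*$ for which there is $t\in\mathcal{L}\setminus\bigcup_{j=1}^r\mathcal{L}\mathcal{M}_j$ with $(ta,tb)\in M$; such a pair exists and its class in $\mathbb{PF}^1_{\mathcal{I}}$ depends only on $M$ (if $M=\mathcal{O}^2$ it is the single element of $\mathbb{PF}^1_{\mathcal{O}}$). -}

module Defs where

open import Level using (Level; _⊔_; suc)
open import Data.Unit.Polymorphic using (⊤; tt)
open import Data.Nat as ℕ using (ℕ; _∸_)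
open import Data.Fin using (Fin; toℕ)
open import Data.Product using (Σ-syntax; ∃-syntax; _×_; _,_)
open import Data.Sum using (_⊎_)
open import Data.Vec.Functional using (Vector; _∷_; foldr)
open import Relation.Nullary using (¬_)
open import Relation.Unary using (Pred)
open import Relation.Binary using (Setoid; _Respects_)
open import Relation.Binary.PropositionalEquality using (_≡_; _≢_)
open import Algebra using (CommutativeMonoid; CommutativeRing; Semiring)
open import Algebra.Module using (Module)
open import Algebra.Module.Structures.Biased using (IsModuleFromLeft)
open import Algebra.Module.Morphism.Structures using (module ModuleMorphisms)
import Algebra.Module.Construct.DirectProduct as DirectProduct
import Algebra.Module.Construct.TensorUnit as TensorUnit
import Algebra.Module.Construct.Zero as Zero
import Algebra.Module.Properties as ModuleProperties
import Algebra.Definitions.RawMagma as RawMagmaDefs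
import Algebra.Definitions.RawMonoid as RawMonoidDefs
import Algebra.Definitions.RawSemiring as RawSemiringDefs
import Algebra.Properties.Ring as RingProperties
import Algebra.Properties.CommutativeSemigroup as CommutativeSemigroupProperties
import Relation.Binary.Reasoning.Setoid as SetoidReasoning

module Over {c ℓ : Level} (𝓞 : CommutativeRing c ℓ) where

  open CommutativeRing 𝓞
  open RawSemiringDefs (Semiring.rawSemiring semiring) using (_^_; _∣_; sum)
  open RawMagmaDefs (Semiring.*-rawMagma semiring) using (_,_)

  -- Submodules are predicates of the single level c ⊔ ℓ, which is closed under
  -- all the operations below; "every ideal" refers to ideals of this level.

  module _ (N : Module 𝓞 c ℓ) where
    open Module N

    record Submodule : Set (suc (c ⊔ ℓ)) where
      field
        member    : Pred Carrierᴹ (c ⊔ ℓ)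
        resp      : member Respects _≈ᴹ_
        0-closed  : member 0ᴹ
        +-closed  : ∀ {x y} → member x → member y → member (x +ᴹ y)
        *ₗ-closed : ∀ r {x} → member x → member (r *ₗ x)

  module _ {N : Module 𝓞 c ℓ} where
    open Module N

    infix 4 _∈_ _∉_ _⊆_ _≐_

    _∈_ _∉_ : Carrierᴹ → Submodule N → Set (c ⊔ ℓ)
    x ∈ M = Submodule.member M x
    x ∉ M = ¬ (x ∈ M)

    _⊆_ _≐_ : Submodule N → Submodule N → Set (c ⊔ ℓ)
    M ⊆ M′ = ∀ {x} → x ∈ M → x ∈ M′
    M ≐ M′ = (M ⊆ M′) × (M′ ⊆ M)

    whole : Submodule N
    whole = record
      { member    = λ _ → ⊤
      ; resp      = λ _ _ → tt
      ; 0-closed  = tt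
      ; +-closed  = λ _ _ → tt
      ; *ₗ-closed = λ _ _ → tt
      }

    ⋂ : ∀ {l} → (Fin l → Submodule N) → Submodule N
    ⋂ M = record
      { member    = λ x → ∀ i → x ∈ M i
      ; resp      = λ x≈y p i → Submodule.resp (M i) x≈y (p i)
      ; 0-closed  = λ i → Submodule.0-closed (M i)
      ; +-closed  = λ p q i → Submodule.+-closed (M i) (p i) (q i)
      ; *ₗ-closed = λ r p i → Submodule.*ₗ-closed (M i) r (p i)
      }

    data Generated (S : Pred Carrierᴹ (c ⊔ ℓ)) : Pred Carrierᴹ (c ⊔ ℓ) where
      gen   : ∀ {x} → S x → Generated S x
      null  : Generated S 0ᴹ
      add   : ∀ {x y} → Generated S x → Generated S y → Generated S (x +ᴹ y)
      scale : ∀ r {x} → Generated S x → Generated S (r *ₗ x)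
      equal : ∀ {x y} → x ≈ᴹ y → Generated S x → Generated S y

    span : Pred Carrierᴹ (c ⊔ ℓ) → Submodule N
    span S = record
      { member    = Generated S
      ; resp      = equal
      ; 0-closed  = null
      ; +-closed  = add
      ; *ₗ-closed = scale
      }

  module _ (N : Module 𝓞 c ℓ) (M : Submodule N) where
    open Module N
    open Submodule M

    private
      module N = Module N
      module P = ModuleProperties N
      open SetoidReasoning N.≈ᴹ-setoid
      open CommutativeSemigroupProperties
             (CommutativeMonoid.commutativeSemigroup N.+ᴹ-commutativeMonoid)
             using (interchange)

      -1*x : ∀ x → (- 1#) *ₗ x ≈ᴹ -ᴹ x
      -1*x x = P.inverseˡ-uniqueᴹ _ _ (begin
        (- 1#) *ₗ x +ᴹ x           ≈⟨ N.+ᴹ-cong N.≈ᴹ-refl (N.≈ᴹ-sym (N.*ₗ-identityˡ x)) ⟩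
        (- 1#) *ₗ x +ᴹ 1# *ₗ x     ≈⟨ N.≈ᴹ-sym (N.*ₗ-distribʳ x (- 1#) 1#) ⟩
        (- 1# + 1#) *ₗ x           ≈⟨ N.*ₗ-cong (-‿inverseˡ 1#) N.≈ᴹ-refl ⟩
        0# *ₗ x                    ≈⟨ N.*ₗ-zeroˡ x ⟩
        0ᴹ                         ∎)

      *-neg : ∀ r x → r *ₗ (-ᴹ x) ≈ᴹ -ᴹ (r *ₗ x)
      *-neg r x = P.inverseˡ-uniqueᴹ _ _ (begin
        r *ₗ (-ᴹ x) +ᴹ r *ₗ x      ≈⟨ N.≈ᴹ-sym (N.*ₗ-distribˡ r (-ᴹ x) x) ⟩
        r *ₗ (-ᴹ x +ᴹ x)           ≈⟨ N.*ₗ-cong refl (N.-ᴹ‿inverseˡ x) ⟩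
        r *ₗ 0ᴹ                    ≈⟨ N.*ₗ-zeroʳ r ⟩
        0ᴹ                         ∎)

      +-neg : ∀ x y → -ᴹ x +ᴹ -ᴹ y ≈ᴹ -ᴹ (x +ᴹ y)
      +-neg x y = P.inverseˡ-uniqueᴹ _ _ (begin
        (-ᴹ x +ᴹ -ᴹ y) +ᴹ (x +ᴹ y) ≈⟨ interchange _ _ _ _ ⟩
        (-ᴹ x +ᴹ x) +ᴹ (-ᴹ y +ᴹ y) ≈⟨ N.+ᴹ-cong (N.-ᴹ‿inverseˡ x) (N.-ᴹ‿inverseˡ y) ⟩
        0ᴹ +ᴹ 0ᴹ                   ≈⟨ N.+ᴹ-identityˡ 0ᴹ ⟩
        0ᴹ                         ∎)

      neg-closed : ∀ {x} → x ∈ M → -ᴹ x ∈ M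
      neg-closed x∈M = resp (-1*x _) (*ₗ-closed (- 1#) x∈M)

      infix 4 _~_
      _~_ : Carrierᴹ → Carrierᴹ → Set (c ⊔ ℓ)
      x ~ y = x +ᴹ -ᴹ y ∈ M

      fromEq : ∀ {x y} → x ≈ᴹ y → x ~ y
      fromEq {x} {y} x≈y = resp (N.≈ᴹ-sym (begin
        x +ᴹ -ᴹ y ≈⟨ N.+ᴹ-cong x≈y N.≈ᴹ-refl ⟩
        y +ᴹ -ᴹ y ≈⟨ N.-ᴹ‿inverseʳ y ⟩
        0ᴹ        ∎)) 0-closed

      ~-sym : ∀ {x y} → x ~ y → y ~ x
      ~-sym {x} {y} p = resp (begin
        -ᴹ (x +ᴹ -ᴹ y)      ≈⟨ N.≈ᴹ-sym (+-neg x (-ᴹ y)) ⟩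
        -ᴹ x +ᴹ -ᴹ (-ᴹ y)   ≈⟨ N.+ᴹ-cong N.≈ᴹ-refl (P.-ᴹ-involutive y) ⟩
        -ᴹ x +ᴹ y           ≈⟨ N.+ᴹ-comm _ _ ⟩
        y +ᴹ -ᴹ x           ∎) (neg-closed p)

      ~-trans : ∀ {x y z} → x ~ y → y ~ z → x ~ z
      ~-trans {x} {y} {z} p q = resp (begin
        (x +ᴹ -ᴹ y) +ᴹ (y +ᴹ -ᴹ z)  ≈⟨ N.+ᴹ-assoc _ _ _ ⟩
        x +ᴹ (-ᴹ y +ᴹ (y +ᴹ -ᴹ z))  ≈⟨ N.+ᴹ-cong N.≈ᴹ-refl (N.≈ᴹ-sym (N.+ᴹ-assoc _ _ _)) ⟩
        x +ᴹ ((-ᴹ y +ᴹ y) +ᴹ -ᴹ z)  ≈⟨ N.+ᴹ-cong N.≈ᴹ-refl (N.+ᴹ-cong (N.-ᴹ‿inverseˡ y) N.≈ᴹ-refl) ⟩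
        x +ᴹ (0ᴹ +ᴹ -ᴹ z)           ≈⟨ N.+ᴹ-cong N.≈ᴹ-refl (N.+ᴹ-identityˡ _) ⟩
        x +ᴹ -ᴹ z                   ∎) (+-closed p q)

      +-cong~ : ∀ {x y u v} → x ~ y → u ~ v → x +ᴹ u ~ y +ᴹ v
      +-cong~ {x} {y} {u} {v} p q = resp (begin
        (x +ᴹ -ᴹ y) +ᴹ (u +ᴹ -ᴹ v)  ≈⟨ interchange _ _ _ _ ⟩
        (x +ᴹ u) +ᴹ (-ᴹ y +ᴹ -ᴹ v)  ≈⟨ N.+ᴹ-cong N.≈ᴹ-refl (+-neg y v) ⟩
        (x +ᴹ u) +ᴹ -ᴹ (y +ᴹ v)     ∎) (+-closed p q)

      *-cong~ : ∀ {r s x y} → r ≈ s → x ~ y → r *ₗ x ~ s *ₗ y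
      *-cong~ {r} {s} {x} {y} r≈s p = resp (begin
        r *ₗ (x +ᴹ -ᴹ y)            ≈⟨ N.*ₗ-distribˡ r x (-ᴹ y) ⟩
        r *ₗ x +ᴹ r *ₗ (-ᴹ y)       ≈⟨ N.+ᴹ-cong N.≈ᴹ-refl (*-neg r y) ⟩
        r *ₗ x +ᴹ -ᴹ (r *ₗ y)       ≈⟨ N.+ᴹ-cong N.≈ᴹ-refl (N.-ᴹ‿cong (N.*ₗ-cong r≈s N.≈ᴹ-refl)) ⟩
        r *ₗ x +ᴹ -ᴹ (s *ₗ y)       ∎) (*ₗ-closed r p)

      neg-cong~ : ∀ {x y} → x ~ y → -ᴹ x ~ -ᴹ y
      neg-cong~ {x} {y} p = resp (N.≈ᴹ-sym (+-neg x (-ᴹ y))) (neg-closed p)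

    -- N / M : the carrier of N with x ≈ y meaning x - y ∈ M.
    infixl 8 _/_
    _/_ : Module 𝓞 c (c ⊔ ℓ)
    _/_ = record
      { isModule = IsModuleFromLeft.isModule {commutativeRing = 𝓞} {≈ᴹ = _~_}
          {+ᴹ = _+ᴹ_} {0ᴹ = 0ᴹ} { -ᴹ = -ᴹ_ } {*ₗ = _*ₗ_} (record
        { isLeftModule = record
          { isLeftSemimodule = record
            { +ᴹ-isCommutativeMonoid = record
              { isMonoid = record
                { isSemigroup = record
                  { isMagma = record
                    { isEquivalence = record
                      { refl  = fromEq N.≈ᴹ-refl
                      ; sym   = ~-sym
                      ; trans = ~-trans
                      }
                    ; ∙-cong = +-cong~
                    }
                  ; assoc = λ x y z → fromEq (N.+ᴹ-assoc x y z)
                  }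
                ; identity = (λ x → fromEq (N.+ᴹ-identityˡ x))
                           , (λ x → fromEq (N.+ᴹ-identityʳ x))
                }
              ; comm = λ x y → fromEq (N.+ᴹ-comm x y)
              }
            ; isPreleftSemimodule = record
              { *ₗ-cong      = *-cong~
              ; *ₗ-zeroˡ     = λ x → fromEq (N.*ₗ-zeroˡ x)
              ; *ₗ-distribʳ  = λ x r s → fromEq (N.*ₗ-distribʳ x r s)
              ; *ₗ-identityˡ = λ x → fromEq (N.*ₗ-identityˡ x)
              ; *ₗ-assoc     = λ r s x → fromEq (N.*ₗ-assoc r s x)
              ; *ₗ-zeroʳ     = λ r → fromEq (N.*ₗ-zeroʳ r)
              ; *ₗ-distribˡ  = λ r x y → fromEq (N.*ₗ-distribˡ r x y)
              }
            }
          ; -ᴹ‿cong    = neg-cong~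
          ; -ᴹ‿inverse = (λ x → fromEq (N.-ᴹ‿inverseˡ x))
                       , (λ x → fromEq (N.-ᴹ‿inverseʳ x))
          }
        })
      }

  _⊕_ : ∀ {m ℓm m′ ℓm′} → Module 𝓞 m ℓm → Module 𝓞 m′ ℓm′ → Module 𝓞 (m ⊔ m′) (ℓm ⊔ ℓm′)
  _⊕_ = DirectProduct.⟨module⟩

  ⨁ : ∀ {r m ℓm} → (Fin r → Module 𝓞 m ℓm) → Module 𝓞 m ℓm
  ⨁ = foldr _⊕_ Zero.⟨module⟩

  infix 4 _≅_
  _≅_ : ∀ {m ℓm m′ ℓm′} → Module 𝓞 m ℓm → Module 𝓞 m′ ℓm′ → Set (c ⊔ m ⊔ ℓm ⊔ m′ ⊔ ℓm′)
  N ≅ N′ = Σ[ f ∈ (Module.Carrierᴹ N → Module.Carrierᴹ N′) ]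
             ModuleMorphisms.IsModuleIsomorphism (Module.rawModule N) (Module.rawModule N′) f

  IsTorsion : ∀ {m ℓm} → Module 𝓞 m ℓm → Set (c ⊔ ℓ ⊔ m ⊔ ℓm)
  IsTorsion N = ∀ x → ∃[ r ] (r ≉ 0#) × (r *ₗ x ≈ᴹ 0ᴹ)
    where open Module N

  module _ {N : Module 𝓞 c ℓ} where
    open Module N
    open RawMonoidDefs +ᴹ-rawMonoid using () renaming (sum to sumᴹ)

    LinearlyIndependent : ∀ {n} → Vector Carrierᴹ n → Set (c ⊔ ℓ)
    LinearlyIndependent {n} v =
      (s : Vector Carrier n) → sumᴹ (λ i → s i *ₗ v i) ≈ᴹ 0ᴹ → ∀ i → s i ≈ 0#

    -- Over a ring with 1 ≉ 0 a linearly independent family has no repetitions,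
    -- so it is the same thing as a linearly independent subset with n elements,
    -- and adjoining to it one of its own members makes it dependent.
    HasRank : Submodule N → ℕ → Set (c ⊔ ℓ)
    HasRank M n = Σ[ v ∈ Vector Carrierᴹ n ]
      (∀ i → v i ∈ M)
      × LinearlyIndependent v
      × (∀ x → x ∈ M → ¬ LinearlyIndependent (x ∷ v))

  𝓞¹ : Module 𝓞 c ℓ
  𝓞¹ = TensorUnit.⟨module⟩

  𝓞² : Module 𝓞 c ℓ
  𝓞² = 𝓞¹ ⊕ 𝓞¹

  IsCotorsion : Submodule 𝓞² → Set (c ⊔ ℓ)
  IsCotorsion M = IsTorsion (𝓞² / M)

  Ideal : Set (suc (c ⊔ ℓ))
  Ideal = Submodule 𝓞¹

  𝟙 : Ideal
  𝟙 = whole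

  ⟨_⟩ : Carrier → Ideal
  ⟨ a ⟩ = record
    { member    = λ x → a ∣ x
    ; resp      = λ x≈y (r , eq) → r , trans eq x≈y
    ; 0-closed  = 0# , zeroˡ a
    ; +-closed  = λ (r , eq) (s , eq′) → r + s , trans (distribʳ a r s) (+-cong eq eq′)
    ; *ₗ-closed = λ t (r , eq) → t * r , trans (*-assoc t r a) (*-congˡ eq)
    }

  infixl 6 _+ⁱ_
  _+ⁱ_ : Ideal → Ideal → Ideal
  I +ⁱ J = record
    { member    = λ x → ∃[ y ] ∃[ z ] y ∈ I × z ∈ J × x ≈ y + z
    ; resp      = λ x≈x′ (y , z , y∈I , z∈J , eq) → y , z , y∈I , z∈J , trans (sym x≈x′) eq
    ; 0-closed  = 0# , 0# , I.0-closed , J.0-closed , sym (+-identityˡ 0#)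
    ; +-closed  = λ (y , z , y∈I , z∈J , eq) (y′ , z′ , y′∈I , z′∈J , eq′) →
        y + y′ , z + z′ , I.+-closed y∈I y′∈I , J.+-closed z∈J z′∈J ,
        trans (+-cong eq eq′) (interchange y z y′ z′)
    ; *ₗ-closed = λ r (y , z , y∈I , z∈J , eq) →
        r * y , r * z , I.*ₗ-closed r y∈I , J.*ₗ-closed r z∈J ,
        trans (*-congˡ eq) (distribˡ r y z)
    }
    where
    module I = Submodule I
    module J = Submodule J
    open CommutativeSemigroupProperties +-commutativeSemigroup using (interchange)

  infixl 7 _·_
  _·_ : Ideal → Ideal → Ideal
  I · J = span (λ x → ∃[ y ] ∃[ z ] y ∈ I × z ∈ J × x ≈ y * z)

  ∏ : ∀ {n} → (Fin n → Ideal) → Ideal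
  ∏ = foldr _·_ 𝟙

  infixr 8 _^ⁱ_
  _^ⁱ_ : Ideal → ℕ → Ideal
  I ^ⁱ n = ∏ {n} (λ _ → I)

  IsPrime : Ideal → Set (c ⊔ ℓ)
  IsPrime P = 1# ∉ P × (∀ x y → x * y ∈ P → x ∈ P ⊎ y ∈ P)

  IsMaximal : Ideal → Set (suc (c ⊔ ℓ))
  IsMaximal P = 1# ∉ P × (∀ (J : Ideal) → P ⊆ J → (J ≐ P) ⊎ (J ≐ 𝟙))

  IsIntegralDomain : Set (c ⊔ ℓ)
  IsIntegralDomain = 1# ≉ 0# × (∀ x y → x * y ≈ 0# → x ≈ 0# ⊎ y ≈ 0#)

  IsNoetherian : Set (suc (c ⊔ ℓ))
  IsNoetherian = (I : ℕ → Ideal) → (∀ n → I n ⊆ I (ℕ.suc n)) →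
                 ∃[ m ] (∀ n → m ℕ.≤ n → I n ≐ I m)

  -- Every fraction p / q that is a root of a monic polynomial
  -- X ^ n + Σ_{i < n} (a i) X ^ i lies in 𝓞.  The equation is the one holding in
  -- the fraction field, multiplied by q ^ n; p / q lies in 𝓞 iff q divides p.
  IsIntegrallyClosed : Set (c ⊔ ℓ)
  IsIntegrallyClosed =
    ∀ n (a : Vector Carrier n) p q → q ≉ 0# →
    p ^ n + sum (λ i → a i * (p ^ toℕ i * q ^ (n ∸ toℕ i))) ≈ 0# → q ∣ p

  -- Fields are allowed.
  record IsDedekindDomain : Set (suc (c ⊔ ℓ)) where
    field
      isIntegralDomain    : IsIntegralDomain
      isNoetherian        : IsNoetherian
      isIntegrallyClosed  : IsIntegrallyClosed
      nonzeroPrimeMaximal : ∀ (P : Ideal) → IsPrime P →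
                            ∃[ x ] (x ∈ P × x ≉ 0#) → IsMaximal P

  record Unimodular : Set (c ⊔ ℓ) where
    constructor uni
    field
      fst snd    : Carrier
      unimodular : ⟨ fst ⟩ +ⁱ ⟨ snd ⟩ ≐ 𝟙

  private
    open RingProperties ring using (-1*x≈-x; x[y-z]≈xy-xz; ⁻¹-anti-homo-//)
    open CommutativeSemigroupProperties *-commutativeSemigroup using (x∙yz≈y∙xz)

    telescope : ∀ x y z → (x - y) + (y - z) ≈ x - z
    telescope x y z = begin
      (x - y) + (y - z)      ≈⟨ +-assoc x (- y) (y - z) ⟩
      x + (- y + (y - z))    ≈⟨ +-congˡ (sym (+-assoc (- y) y (- z))) ⟩
      x + ((- y + y) - z)    ≈⟨ +-congˡ (+-congʳ (-‿inverseˡ y)) ⟩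
      x + (0# - z)           ≈⟨ +-congˡ (+-identityˡ (- z)) ⟩
      x - z                  ∎
      where open SetoidReasoning setoid

    combine : ∀ p q r s t w → p * (q * s - r * t) + t * (p * r - w) ≈ q * (p * s) - t * w
    combine p q r s t w = begin
      p * (q * s - r * t) + t * (p * r - w)
        ≈⟨ +-cong (x[y-z]≈xy-xz p _ _) (x[y-z]≈xy-xz t _ _) ⟩
      (p * (q * s) - p * (r * t)) + (t * (p * r) - t * w)
        ≈⟨ +-congˡ (+-congʳ (trans (x∙yz≈y∙xz t p r) (*-congˡ (*-comm t r)))) ⟩
      (p * (q * s) - p * (r * t)) + (p * (r * t) - t * w)
        ≈⟨ telescope _ _ _ ⟩
      p * (q * s) - t * w
        ≈⟨ +-congʳ (x∙yz≈y∙xz p q s) ⟩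
      q * (p * s) - t * w
        ∎
      where open SetoidReasoning setoid

    bezout : ∀ a b → ⟨ a ⟩ +ⁱ ⟨ b ⟩ ≐ 𝟙 → ∃[ u ] ∃[ v ] 1# ≈ u * a + v * b
    bezout a b (_ , full) with full {1#} tt
    ... | y , z , (u , ua≈y) , (v , vb≈z) , eq =
      u , v , trans eq (+-cong (sym ua≈y) (sym vb≈z))

  -- PF¹ I : elements are unimodular pairs (a , b), with (a , b) ≈ (c , d) meaning
  -- ad - bc ∈ I.
  PF¹ : Ideal → Setoid (c ⊔ ℓ) (c ⊔ ℓ)
  PF¹ I = record
    { Carrier       = Unimodular
    ; _≈_           = _~_
    ; isEquivalence = record
      { refl  = λ {p} → ~-refl p
      ; sym   = λ {p} {q} → ~-sym p q
      ; trans = λ {p} {q} {r} → ~-trans p q r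
      }
    }
    where
    open Submodule I

    _~_ : Unimodular → Unimodular → Set (c ⊔ ℓ)
    (uni a b _) ~ (uni c d _) = a * d - b * c ∈ I

    ~-refl : ∀ p → p ~ p
    ~-refl (uni a b _) =
      resp (sym (trans (+-congˡ (-‿cong (*-comm b a))) (-‿inverseʳ (a * b)))) 0-closed

    ~-sym : ∀ p q → p ~ q → q ~ p
    ~-sym (uni a b _) (uni c d _) m = resp
      (trans (-1*x≈-x _) (trans (⁻¹-anti-homo-// _ _)
        (+-cong (*-comm b c) (-‿cong (*-comm a d)))))
      (*ₗ-closed (- 1#) m)

    ~-trans : ∀ p q r → p ~ q → q ~ r → p ~ r
    ~-trans (uni a b _) (uni c d cd) (uni e f _) m n with bezout c d cd
    ... | u , v , 1≈ = resp total (+-closed (*ₗ-closed u c-part) (*ₗ-closed v d-part))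
      where
      open SetoidReasoning setoid

      c-part : c * (a * f - b * e) ∈ I
      c-part = resp (begin
        a * (c * f - d * e) + e * (a * d - b * c) ≈⟨ combine a c d f e (b * c) ⟩
        c * (a * f) - e * (b * c)                 ≈⟨ +-congˡ (-‿cong (begin
          e * (b * c) ≈⟨ *-congˡ (*-comm b c) ⟩
          e * (c * b) ≈⟨ x∙yz≈y∙xz e c b ⟩
          c * (e * b) ≈⟨ *-congˡ (*-comm e b) ⟩
          c * (b * e) ∎)) ⟩
        c * (a * f) - c * (b * e)                 ≈⟨ x[y-z]≈xy-xz c _ _ ⟨
        c * (a * f - b * e)                       ∎)
        (+-closed (*ₗ-closed a n) (*ₗ-closed e m))

      d-part : d * (a * f - b * e) ∈ I
      d-part = resp (begin
        f * (a * d - b * c) + b * (c * f - d * e)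
          ≈⟨ +-congʳ (*-congˡ (+-congˡ (-‿cong (*-comm b c)))) ⟩
        f * (a * d - c * b) + b * (c * f - d * e)
          ≈⟨ +-congˡ (*-congˡ (+-congʳ (*-comm c f))) ⟩
        f * (a * d - c * b) + b * (f * c - d * e)
          ≈⟨ combine f a c d b (d * e) ⟩
        a * (f * d) - b * (d * e)
          ≈⟨ +-cong (trans (*-congˡ (*-comm f d)) (x∙yz≈y∙xz a d f))
                    (-‿cong (x∙yz≈y∙xz b d e)) ⟩
        d * (a * f) - d * (b * e)
          ≈⟨ x[y-z]≈xy-xz d _ _ ⟨
        d * (a * f - b * e)
          ∎)
        (+-closed (*ₗ-closed f m) (*ₗ-closed b n))

      total : u * (c * (a * f - b * e)) + v * (d * (a * f - b * e)) ≈ a * f - b * e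
      total = begin
        u * (c * (a * f - b * e)) + v * (d * (a * f - b * e))
          ≈⟨ +-cong (sym (*-assoc u c _)) (sym (*-assoc v d _)) ⟩
        u * c * (a * f - b * e) + v * d * (a * f - b * e)
          ≈⟨ distribʳ _ (u * c) (v * d) ⟨
        (u * c + v * d) * (a * f - b * e)
          ≈⟨ *-congʳ (sym 1≈) ⟩
        1# * (a * f - b * e)
          ≈⟨ *-identityˡ _ ⟩
        a * f - b * e
          ∎

  record Invariants (M : Submodule 𝓞²) : Set (suc (c ⊔ ℓ)) where
    field
      r         : ℕ
      𝓜         : Fin r → Ideal
      maximal   : ∀ j → IsMaximal (𝓜 j)
      distinct  : ∀ i j → 𝓜 i ≐ 𝓜 j → i ≡ j
      n k       : Fin r → ℕ
      n≤k       : ∀ j → n j ℕ.≤ k j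
      k≢0       : ∀ j → k j ≢ 0
      decompose : 𝓞² / M ≅ ⨁ (λ j → (𝓞¹ / (𝓜 j ^ⁱ n j)) ⊕ (𝓞¹ / (𝓜 j ^ⁱ k j)))

    𝓛 𝓚 𝓘 : Ideal
    𝓛 = ∏ (λ j → 𝓜 j ^ⁱ n j)
    𝓚 = ∏ (λ j → 𝓜 j ^ⁱ k j)
    𝓘 = ∏ (λ j → 𝓜 j ^ⁱ (k j ∸ n j))

  -- Over a Dedekind domain the family (𝓜 j , n j , k j) is determined by M up to
  -- reindexing and ≐, hence so are 𝓛, 𝓚 and 𝓘; asking below for some
  -- Invariants M is therefore the same as asking about the invariants of M.
  record AreInvariantFactors (M : Submodule 𝓞²) (L K : Ideal) : Set (suc (c ⊔ ℓ)) where
    field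
      invariants : Invariants M
    open Invariants invariants
    field
      L≐𝓛 : L ≐ 𝓛
      K≐𝓚 : K ≐ 𝓚

  -- The class of p in PF¹ I is the projective space invariant element of M: it is
  -- the class of a pair (a , b) with (t a , t b) ∈ M for a t as below.
  record IsProjectiveInvariant (M : Submodule 𝓞²) (I : Ideal) (p : Unimodular)
         : Set (suc (c ⊔ ℓ)) where
    field
      invariants : Invariants M
    open Invariants invariants
    field
      I≐𝓘            : I ≐ 𝓘
      representative : Unimodular
    open Unimodular representative renaming (fst to a; snd to b)
    field
      t       : Carrier
      t∈𝓛     : t ∈ 𝓛
      t∉𝓛𝓜    : ∀ j → t ∉ 𝓛 · 𝓜 j
      ta,tb∈M : (t * a , t * b) ∈ M
      class   : Setoid._≈_ (PF¹ I) p representative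

{-# OPTIONS --safe #-}

-- Each 𝓚 i is the annihilator of 𝓞² / M i, and 𝓞² / ⋂ M ≅ ⨁ 𝓞² / M i by the Chinese
-- remainder theorem, which gives the invariant factors.  Bézout's identity for the pair
-- (a , b) lets a representative of the projective invariant of M i be replaced by (a , b)
-- itself; with e + f = 1, e ∈ 𝓚₁², f ∈ 𝓚₂², the witness for M₁ ∩ M₂ is f t₁ + e t₂.
--
-- For the last part, 𝓞 is a discrete valuation ring at every nonzero maximal ideal P: if
-- 0 ≠ a ∈ P, Noetherianity gives y with P = (a : y), and y P ⊆ a P would make y / a
-- integral.  Valuations at the 𝓜 j then cancel 𝓘 from L · 𝓘 = 𝓛 · 𝓘, so L ⊆ 𝓛, and show
-- that t generates 𝓛 locally at each 𝓜 j, hence that 𝓛 (a , b) ⊆ M.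

module Submission where

open import Defs
open import Level as Level using (Level; Lift; lift; lower; _⊔_)
open import Data.Fin using (Fin; zero; suc; toℕ)
import Data.Fin.Properties as Fin
open import Data.Nat as ℕ using (ℕ; zero; suc; _∸_)
import Data.Nat.Properties as ℕ
open import Data.Product using (Σ-syntax; ∃-syntax; _×_; _,_; proj₁; proj₂)
open import Data.Sum using (_⊎_; inj₁; inj₂)
open import Data.Unit.Polymorphic using (tt)
open import Data.Vec.Functional using (Vector; _∷_; [])
open import Function using (_∘_)
open import Relation.Binary using (Setoid)
open import Relation.Binary.PropositionalEquality as ≡ using (_≡_; _≢_)
open import Relation.Nullary using (¬_; contradiction; Dec; yes; no)
open import Relation.Nullary.Decidable using (map′; decidable-stable)
open import Algebra using (CommutativeRing)
open import Algebra.Module using (Module)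
open import Algebra.Module.Morphism.Structures using (module ModuleMorphisms)
import Algebra.Module.Properties as ModuleProperties
import Algebra.Solver.Ring.NaturalCoefficients.Default as NaturalSolver
open import Axiom.ExcludedMiddle using (ExcludedMiddle)

-- The obstacle is that `factors` and `classes` each bring a decomposition of `𝓞² / M i` of their
-- own, and nothing identifies the two. Inclusions between their ideals carry the information
-- across: `𝓚` depends on `M i` alone, and `𝓛` is reached from `𝓚` by cancelling `𝓘`, which is where
-- valuations come in. Everything local is phrased inside `𝓞`. A unit at `P` is an element `s ∉ P`,
-- a statement at `P` is one that holds after multiplication by such an element, and a valuation is
-- read off from membership in `P ^ⁱ n`. Two devices return from local to global: pairwise coprime
-- powers intersect in their product, and an ideal that contains `𝓚` and lies in no `𝓜 j` is the
-- whole ring. A uniformizer at `𝓜 j` requires a nonzero element of `𝓜 j`; co-torsion supplies it.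

-- Unlike Data.Vec.Functional._++_, this satisfies cat xs ys ∘ suc = cat (xs ∘ suc) ys definitionally.
cat : ∀ {a} {A : Set a} {m n} → Vector A m → Vector A n → Vector A (m ℕ.+ n)
cat {m = zero}  xs ys i       = ys i
cat {m = suc m} xs ys zero    = xs zero
cat {m = suc m} xs ys (suc i) = cat (xs ∘ suc) ys i

cat-all : ∀ {a p} {A : Set a} {m n} (P : A → Set p) (xs : Vector A m) (ys : Vector A n) →
          (∀ i → P (xs i)) → (∀ i → P (ys i)) → ∀ i → P (cat xs ys i)
cat-all {m = zero}  P xs ys f g i       = g i
cat-all {m = suc m} P xs ys f g zero    = f zero
cat-all {m = suc m} P xs ys f g (suc i) = cat-all P (xs ∘ suc) ys (f ∘ suc) g i

-- Arithmetic of ideals: products, coprimality, maximal ideals.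

module IdealTheory {c ℓ} (𝓞 : CommutativeRing c ℓ) where

  open CommutativeRing 𝓞 hiding (zero)
  open Over 𝓞
  open import Algebra.Properties.Semiring.Exp semiring using (_^_)
  open import Algebra.Definitions.RawMagma *-rawMagma using (_,_)
  import Relation.Binary.Reasoning.Setoid as SetoidReasoning
  open NaturalSolver commutativeSemiring using (solve; _:=_; _:+_; _:*_)

  module _ {N : Module 𝓞 c ℓ} (M : Submodule N) where
    open Module N
    open Submodule M

    -- The colon ideal. As the target of `·-least` it holds one factor fixed while a product of
    -- ideals is eliminated; with `M = ⟨ a ⟩` it is the ideal (a : y) of the valuation argument.
    _∶_ : Carrierᴹ → Ideal
    _∶_ v = record
      { member    = λ r → r *ₗ v ∈ M
      ; resp      = λ r≈s → resp (*ₗ-cong r≈s ≈ᴹ-refl)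
      ; 0-closed  = resp (≈ᴹ-sym (*ₗ-zeroˡ v)) 0-closed
      ; +-closed  = λ {r} {s} p q → resp (≈ᴹ-sym (*ₗ-distribʳ v r s)) (+-closed p q)
      ; *ₗ-closed = λ r {s} p → resp (≈ᴹ-sym (*ₗ-assoc r s v)) (*ₗ-closed r p)
      }

  module _ (I : Ideal) where
    open Submodule I

    *ʳ-closed : ∀ r {x} → x ∈ I → x * r ∈ I
    *ʳ-closed r {x} p = resp (*-comm r x) (*ₗ-closed r p)

    +-cancelʳ-∈ : ∀ {x y} → x + y ∈ I → y ∈ I → x ∈ I
    +-cancelʳ-∈ {x} {y} p q = resp eq (+-closed p (*ₗ-closed (- 1#) q))
      where
      open import Algebra.Properties.Ring ring using (-1*x≈-x)
      eq : (x + y) + (- 1#) * y ≈ x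
      eq = trans (+-congˡ (-1*x≈-x y)) (trans (+-assoc x y (- y))
             (trans (+-congˡ (-‿inverseʳ y)) (+-identityʳ x)))

  ·-intro : ∀ {I J : Ideal} {x y} → x ∈ I → y ∈ J → x * y ∈ I · J
  ·-intro p q = gen (_ , _ , p , q , refl)

  ·-least : ∀ {I J C : Ideal} → (∀ {x y} → x ∈ I → y ∈ J → x * y ∈ C) → I · J ⊆ C
  ·-least {C = C} f = go
    where
    open Submodule C
    go : ∀ {z} → Generated _ z → z ∈ C
    go (gen (_ , _ , p , q , eq)) = resp (sym eq) (f p q)
    go null                       = 0-closed
    go (add p q)                  = +-closed (go p) (go q)
    go (scale r p)                = *ₗ-closed r (go p)
    go (equal eq p)               = resp eq (go p)

  ·⊆ˡ : ∀ {I J : Ideal} → I · J ⊆ I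
  ·⊆ˡ {I} {J} = ·-least {I} {J} {I} (λ p _ → *ʳ-closed I _ p)

  ·⊆ʳ : ∀ {I J : Ideal} → I · J ⊆ J
  ·⊆ʳ {I} {J} = ·-least {I} {J} {J} (λ _ q → Submodule.*ₗ-closed J _ q)

  ·-mono : ∀ {I I′ J J′ : Ideal} → I ⊆ I′ → J ⊆ J′ → I · J ⊆ I′ · J′
  ·-mono {I} {I′} {J} {J′} f g = ·-least {I} {J} {I′ · J′} (λ p q → ·-intro {I′} {J′} (f p) (g q))

  ·-cong : ∀ {I I′ J J′ : Ideal} → I ≐ I′ → J ≐ J′ → I · J ≐ I′ · J′
  ·-cong {I} {I′} {J} {J′} (f , f′) (g , g′) = ·-mono {I} {I′} {J} {J′} f g , ·-mono {I′} {I} {J′} {J} f′ g′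

  ·-assoc : ∀ {I J K : Ideal} → (I · J) · K ≐ I · (J · K)
  ·-assoc {I} {J} {K} =
      ·-least {I · J} {K} {I · (J · K)} (λ {x} {z} p z∈K →
        ·-least {I} {J} {(I · (J · K)) ∶ z} (λ x∈I y∈J →
          Submodule.resp (I · (J · K)) (sym (*-assoc _ _ _)) (·-intro {I} {J · K} x∈I (·-intro {J} {K} y∈J z∈K))) p)
    , ·-least {I} {J · K} {(I · J) · K} (λ {x} {y} x∈I q →
        Submodule.resp ((I · J) · K) (*-comm y x)
          (·-least {J} {K} {((I · J) · K) ∶ x} (λ {y} {z} y∈J z∈K →
            Submodule.resp ((I · J) · K) (trans (*-assoc x y z) (*-comm x (y * z)))
              (·-intro {I · J} {K} (·-intro {I} {J} x∈I y∈J) z∈K)) q))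

  ∏-cong : ∀ {n} {A B : Fin n → Ideal} → (∀ i → A i ≐ B i) → ∏ A ≐ ∏ B
  ∏-cong {zero}  f = (λ p → p) , (λ p → p)
  ∏-cong {suc n} {A} {B} f = ·-cong {A zero} {B zero} {∏ (A ∘ suc)} {∏ (B ∘ suc)} (f zero) (∏-cong (f ∘ suc))

  ∏-mono : ∀ {n} {A B : Fin n → Ideal} → (∀ i → A i ⊆ B i) → ∏ A ⊆ ∏ B
  ∏-mono {zero}  f = λ p → p
  ∏-mono {suc n} {A} {B} f = ·-mono {A zero} {B zero} {∏ (A ∘ suc)} {∏ (B ∘ suc)} (f zero) (∏-mono (λ i → f (suc i)))

  ∏⊆ : ∀ {n} (A : Fin n → Ideal) i → ∏ A ⊆ A i
  ∏⊆ A zero    p = ·⊆ˡ {A zero} {∏ (A ∘ suc)} p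
  ∏⊆ A (suc i) p = ∏⊆ (A ∘ suc) i (·⊆ʳ {A zero} {∏ (A ∘ suc)} p)

  -- A record instead of a synonym for the membership, so that `I` and `J` can be inferred from a
  -- proof.
  record Coprime (I J : Ideal) : Set (c ⊔ ℓ) where
    constructor coprime
    field
      1∈I+J : 1# ∈ I +ⁱ J

  coprime-sym : ∀ {I J} → Coprime I J → Coprime J I
  coprime-sym (coprime (x , y , p , q , eq)) = coprime (y , x , q , p , trans eq (+-comm x y))

  coprime-mono : ∀ {I I′ J J′ : Ideal} → I ⊆ I′ → J ⊆ J′ → Coprime I J → Coprime I′ J′
  coprime-mono f g (coprime (x , y , p , q , eq)) = coprime (x , y , f p , g q , eq)

  coprime-𝟙 : ∀ {I} → Coprime I 𝟙
  coprime-𝟙 {I} = coprime (0# , 1# , Submodule.0-closed I , tt , sym (+-identityˡ 1#))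

  -- Multiply the two decompositions of `1#`: every term except `y * y′` has a factor in `I`.
  coprime-· : ∀ {I J K} → Coprime I J → Coprime I K → Coprime I (J · K)
  coprime-· {I} {J} {K} (coprime (x , y , p , q , eq)) (coprime (x′ , y′ , p′ , q′ , eq′)) = coprime (
    x * (x′ + y′) + y * x′ , y * y′ ,
    I.+-closed (*ʳ-closed I _ p) (I.*ₗ-closed y p′) , ·-intro {J} {K} q q′ ,
    (begin
      1#                                   ≈⟨ *-identityˡ 1# ⟨
      1# * 1#                              ≈⟨ *-cong eq eq′ ⟩
      (x + y) * (x′ + y′)                  ≈⟨ solve 4 (λ x y x′ y′ → (x :+ y) :* (x′ :+ y′) := (x :* (x′ :+ y′) :+ y :* x′) :+ y :* y′) refl x y x′ y′ ⟩
      (x * (x′ + y′) + y * x′) + y * y′    ∎))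
    where
    module I = Submodule I
    open SetoidReasoning setoid

  coprime-∏ : ∀ {n I} {A : Fin n → Ideal} → (∀ i → Coprime I (A i)) → Coprime I (∏ A)
  coprime-∏ {zero}  f = coprime-𝟙
  coprime-∏ {suc n} f = coprime-· (f zero) (coprime-∏ (f ∘ suc))

  coprime-^ : ∀ {I J} n → Coprime I J → Coprime I (J ^ⁱ n)
  coprime-^ n p = coprime-∏ {n} (λ _ → p)

  coprime-^-^ : ∀ {I J} m n → Coprime I J → Coprime (I ^ⁱ m) (J ^ⁱ n)
  coprime-^-^ {I} {J} m n p =
    coprime-sym (coprime-^ m (coprime-sym (coprime-^ n p)))

  Pairwise : ∀ {n} → (Fin n → Ideal) → Set (c ⊔ ℓ)
  Pairwise A = ∀ i j → i ≢ j → Coprime (A i) (A j)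

  pairwise-tail : ∀ {n} {A : Fin (suc n) → Ideal} → Pairwise A → Pairwise (A ∘ suc)
  pairwise-tail f i j i≢j = f (suc i) (suc j) (i≢j ∘ Fin.suc-injective)

  -- Split `x = u x + x v` along `1# = u + v`, with `u` in the head and `v` in the product of the
  -- tail. The first `x` counts as a member of the tail product, the second as a member of the head.
  ⋂⊆∏ : ∀ {n} (A : Fin n → Ideal) → Pairwise A → ∀ {x} → (∀ i → x ∈ A i) → x ∈ ∏ A
  ⋂⊆∏ {zero}  A f p = tt
  ⋂⊆∏ {suc n} A f {x} p with coprime-∏ {I = A zero} {A ∘ suc} (λ i → f zero (suc i) λ ())
  ... | coprime (u , v , u∈ , v∈ , eq) = P.resp (begin
          u * x + x * v   ≈⟨ solve 3 (λ u v x → u :* x :+ x :* v := x :* (u :+ v)) refl u v x ⟩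
          x * (u + v)     ≈⟨ *-congˡ eq ⟨
          x * 1#          ≈⟨ *-identityʳ x ⟩
          x               ∎)
        (P.+-closed (·-intro {A zero} {∏ (A ∘ suc)} u∈ (⋂⊆∏ (A ∘ suc) (pairwise-tail {A = A} f) (p ∘ suc)))
                    (·-intro {A zero} {∏ (A ∘ suc)} (p zero) v∈))
    where
    module P = Submodule (∏ A)
    open SetoidReasoning setoid

  ^-mono-∈ : ∀ {I : Ideal} n {x} → x ∈ I → x ^ n ∈ I ^ⁱ n
  ^-mono-∈ zero p = tt
  ^-mono-∈ {I} (suc n) p = ·-intro {I} {I ^ⁱ n} p (^-mono-∈ {I} n p)

  ^ⁱ-+ : ∀ (I : Ideal) m n {x y} → x ∈ I ^ⁱ m → y ∈ I ^ⁱ n → x * y ∈ I ^ⁱ (m ℕ.+ n)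
  ^ⁱ-+ I zero    n {x} p q = Submodule.*ₗ-closed (I ^ⁱ n) x q
  ^ⁱ-+ I (suc m) n {x} {y} p q =
    ·-least {I} {I ^ⁱ m} {(I ^ⁱ (suc m ℕ.+ n)) ∶ y} (λ {u} {v} u∈ v∈ →
      Submodule.resp (I ^ⁱ (suc m ℕ.+ n)) (sym (*-assoc u v y)) (·-intro {I} {I ^ⁱ (m ℕ.+ n)} u∈ (^ⁱ-+ I m n v∈ q))) p

  ^ⁱ-antitone : ∀ (I : Ideal) {m n} → m ℕ.≤ n → I ^ⁱ n ⊆ I ^ⁱ m
  ^ⁱ-antitone I ℕ.z≤n     p = tt
  ^ⁱ-antitone I (ℕ.s≤s {m} {n} m≤n) p = ·-mono {I} {I} {I ^ⁱ n} {I ^ⁱ m} (λ q → q) (^ⁱ-antitone I m≤n) p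

  -- `P +ⁱ I` contains `x`, so it cannot be `P`, and maximality makes it the whole ring.
  maximal-coprime : ∀ {P : Ideal} → IsMaximal P → ∀ {I x} → x ∈ I → x ∉ P → Coprime I P
  maximal-coprime {P} (_ , max) {I} {x} x∈I x∉P with max (P +ⁱ I)
      (λ {y} y∈P → y , 0# , y∈P , Submodule.0-closed I , sym (+-identityʳ y))
  ... | inj₁ (f , _) = contradiction (f (0# , x , Submodule.0-closed P , x∈I , sym (+-identityˡ x))) x∉P
  ... | inj₂ (_ , f) = coprime-sym (coprime (f tt))

  coprime⇒∉ : ∀ {I P : Ideal} → 1# ∉ P → Coprime I P → ∃[ w ] (w ∈ I × w ∉ P)
  coprime⇒∉ {I} {P} 1∉P (coprime (w , p , w∈I , p∈P , eq)) =
    w , w∈I , λ w∈P → 1∉P (Submodule.resp P (sym eq) (Submodule.+-closed P w∈P p∈P))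

  maximal-prime : ∀ {P : Ideal} → IsMaximal P → ∀ {x y} → x ∉ P → x * y ∈ P → y ∈ P
  maximal-prime {P} max {x} {y} x∉P xy∈P
    with maximal-coprime {P} max {⟨ x ⟩} (1# , *-identityˡ x) x∉P
  ... | coprime (w , p , (u , ux≈w) , p∈P , eq) = P.resp (begin
          u * (x * y) + y * p  ≈⟨ solve 4 (λ u x y p → u :* (x :* y) :+ y :* p := (u :* x :+ p) :* y) refl u x y p ⟩
          (u * x + p) * y      ≈⟨ *-congʳ (+-congʳ ux≈w) ⟩
          (w + p) * y          ≈⟨ *-congʳ eq ⟨
          1# * y               ≈⟨ *-identityˡ y ⟩
          y                    ∎) (P.+-closed (P.*ₗ-closed u xy∈P) (P.*ₗ-closed y p∈P))
    where
    module P = Submodule P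
    open SetoidReasoning setoid

-- Module isomorphisms, the Chinese remainder theorem, annihilators.

module ModuleTheory {c ℓ} (𝓞 : CommutativeRing c ℓ) where

  open CommutativeRing 𝓞 hiding (zero)
  open Over 𝓞
  open IdealTheory 𝓞

  private
    variable
      m₁ ℓ₁ m₂ ℓ₂ m₃ ℓ₃ m₄ ℓ₄ : Level

  module _ {N : Module 𝓞 m₁ ℓ₁} {N′ : Module 𝓞 m₂ ℓ₂} where
    private
      module N  = Module N
      module N′ = Module N′

    -- Zero, negatives and the right action are preserved as a consequence of additivity and left
    -- linearity, so every isomorphism below is built from these arguments only.
    linear-≅ : (f : N.Carrierᴹ → N′.Carrierᴹ) →
      (∀ {x y} → x N.≈ᴹ y → f x N′.≈ᴹ f y) →
      (∀ x y → f (x N.+ᴹ y) N′.≈ᴹ f x N′.+ᴹ f y) →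
      (∀ r x → f (r N.*ₗ x) N′.≈ᴹ r N′.*ₗ f x) →
      (∀ {x y} → f x N′.≈ᴹ f y → x N.≈ᴹ y) →
      (∀ y → ∃[ x ] f x N′.≈ᴹ y) →
      N ≅ N′
    linear-≅ f cong +-homo *-homo inj surj = f , record
      { isModuleMonomorphism = record
        { isModuleHomomorphism = record
          { isBimoduleHomomorphism = record
            { +ᴹ-isGroupHomomorphism = record
              { isMonoidHomomorphism = record
                { isMagmaHomomorphism = record
                  { isRelHomomorphism = record { cong = cong }
                  ; homo              = +-homo
                  }
                ; ε-homo = 0-homo
                }
              ; ⁻¹-homo = neg-homo
              }
            ; *ₗ-homo = *-homo
            ; *ᵣ-homo = λ r x → N′.≈ᴹ-trans (cong (N.≈ᴹ-sym (N.*ₗ-*ᵣ-coincident r x)))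
                (N′.≈ᴹ-trans (*-homo r x) (N′.*ₗ-*ᵣ-coincident r (f x)))
            }
          }
        ; injective = inj
        }
      ; surjective = λ y → let (x , fx≈y) = surj y in x , λ z≈x → N′.≈ᴹ-trans (cong z≈x) fx≈y
      }
      where
      0-homo : f N.0ᴹ N′.≈ᴹ N′.0ᴹ
      0-homo = N′.≈ᴹ-trans (cong (N.≈ᴹ-sym (N.*ₗ-zeroˡ N.0ᴹ)))
                 (N′.≈ᴹ-trans (*-homo 0# N.0ᴹ) (N′.*ₗ-zeroˡ (f N.0ᴹ)))

      neg-homo : ∀ x → f (N.-ᴹ x) N′.≈ᴹ N′.-ᴹ f x
      neg-homo x = ModuleProperties.inverseˡ-uniqueᴹ N′ (f (N.-ᴹ x)) (f x)
        (N′.≈ᴹ-trans (N′.≈ᴹ-sym (+-homo (N.-ᴹ x) x)) (N′.≈ᴹ-trans (cong (N.-ᴹ‿inverseˡ x)) 0-homo))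

  module Iso {N : Module 𝓞 m₁ ℓ₁} {N′ : Module 𝓞 m₂ ℓ₂} (φ : N ≅ N′) where
    private
      module N  = Module N
      module N′ = Module N′
    open ModuleMorphisms.IsModuleIsomorphism (proj₂ φ) public using (⟦⟧-cong; +ᴹ-homo; *ₗ-homo; 0ᴹ-homo; injective)

    to : N.Carrierᴹ → N′.Carrierᴹ
    to = proj₁ φ

    onto : ∀ y → ∃[ x ] to x N′.≈ᴹ y
    onto y = let (x , eq) = ModuleMorphisms.IsModuleIsomorphism.surjective (proj₂ φ) y in x , eq N.≈ᴹ-refl

  ≅-trans : {N : Module 𝓞 m₁ ℓ₁} {N′ : Module 𝓞 m₂ ℓ₂} {N″ : Module 𝓞 m₃ ℓ₃} →
            N ≅ N′ → N′ ≅ N″ → N ≅ N″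
  ≅-trans {N = N} {N′} {N″} φ ψ = linear-≅ {N = N} {N″} (ψ.to ∘ φ.to)
    (ψ.⟦⟧-cong ∘ φ.⟦⟧-cong)
    (λ x y → N″.≈ᴹ-trans (ψ.⟦⟧-cong (φ.+ᴹ-homo x y)) (ψ.+ᴹ-homo _ _))
    (λ r x → N″.≈ᴹ-trans (ψ.⟦⟧-cong (φ.*ₗ-homo r x)) (ψ.*ₗ-homo _ _))
    (φ.injective ∘ ψ.injective)
    (λ z → let (y , eq) = ψ.onto z ; (x , eq′) = φ.onto y in x , N″.≈ᴹ-trans (ψ.⟦⟧-cong eq′) eq)
    where
    module φ  = Iso {N = N} {N′} φ
    module ψ  = Iso {N = N′} {N″} ψ
    module N″ = Module N″

  ⊕-cong : {N : Module 𝓞 m₁ ℓ₁} {N′ : Module 𝓞 m₂ ℓ₂} {P : Module 𝓞 m₃ ℓ₃} {P′ : Module 𝓞 m₄ ℓ₄} →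
           N ≅ N′ → P ≅ P′ → N ⊕ P ≅ N′ ⊕ P′
  ⊕-cong {N = N} {N′} {P} {P′} φ ψ = linear-≅ {N = N ⊕ P} {N′ ⊕ P′}
    (λ (x , y) → φ.to x , ψ.to y)
    (λ (p , q) → φ.⟦⟧-cong p , ψ.⟦⟧-cong q)
    (λ (x , y) (x′ , y′) → φ.+ᴹ-homo x x′ , ψ.+ᴹ-homo y y′)
    (λ r (x , y) → φ.*ₗ-homo r x , ψ.*ₗ-homo r y)
    (λ (p , q) → φ.injective p , ψ.injective q)
    (λ (x , y) → let (u , eq) = φ.onto x ; (v , eq′) = ψ.onto y in (u , v) , (eq , eq′))
    where
    module φ  = Iso {N = N} {N′} φ
    module ψ  = Iso {N = P} {P′} ψ

  ⨁-cong : ∀ {r} {N : Fin r → Module 𝓞 m₁ ℓ₁} {N′ : Fin r → Module 𝓞 m₁ ℓ₂} →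
           (∀ i → N i ≅ N′ i) → ⨁ N ≅ ⨁ N′
  ⨁-cong {r = zero} {N} {N′} φ = linear-≅ {N = ⨁ N} {⨁ N′} (λ x → x) (λ _ → tt) (λ _ _ → tt) (λ _ _ → tt)
    (λ _ → tt) (λ y → y , tt)
  ⨁-cong {r = suc r} {N} {N′} φ = ⊕-cong {N = N zero} {N′ zero} {⨁ (N ∘ suc)} {⨁ (N′ ∘ suc)}
    (φ zero) (⨁-cong (φ ∘ suc))

  ⨁-cat : ∀ {a} {A : Set a} {m n} (H : A → Module 𝓞 m₁ ℓ₁) (xs : Vector A m) (ys : Vector A n) →
          ⨁ (λ i → H (xs i)) ⊕ ⨁ (λ i → H (ys i)) ≅ ⨁ (λ i → H (cat xs ys i))
  ⨁-cat {m = zero} H xs ys = linear-≅ {N = ⨁ (H ∘ xs) ⊕ ⨁ (H ∘ ys)} {⨁ (H ∘ cat xs ys)}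
    proj₂ proj₂ (λ _ _ → Y.≈ᴹ-refl) (λ _ _ → Y.≈ᴹ-refl) (λ p → tt , p) (λ y → (tt , y) , Y.≈ᴹ-refl)
    where module Y = Module (⨁ (H ∘ ys))
  ⨁-cat {m = suc m} H xs ys = linear-≅ {N = ⨁ (H ∘ xs) ⊕ ⨁ (H ∘ ys)} {⨁ (H ∘ cat xs ys)}
    (λ ((h , x) , y) → h , IH.to (x , y))
    (λ ((e , p) , q) → e , IH.⟦⟧-cong (p , q))
    (λ ((h , x) , y) ((h′ , x′) , y′) → H₀.≈ᴹ-refl , IH.+ᴹ-homo (x , y) (x′ , y′))
    (λ r ((h , x) , y) → H₀.≈ᴹ-refl , IH.*ₗ-homo r (x , y))
    (λ (e , p) → (e , proj₁ (IH.injective p)) , proj₂ (IH.injective p))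
    (λ (h , z) → let ((x , y) , eq) = IH.onto z in ((h , x) , y) , (H₀.≈ᴹ-refl , eq))
    where
    module H₀ = Module (H (xs zero))
    module IH = Iso {N = ⨁ (H ∘ xs ∘ suc) ⊕ ⨁ (H ∘ ys)} {⨁ (H ∘ cat (xs ∘ suc) ys)}
                  (⨁-cat H (xs ∘ suc) ys)

  module _ {N : Module 𝓞 c ℓ} where
    open Module N

    -0ᴹ-identityʳ : ∀ x → x +ᴹ -ᴹ 0ᴹ ≈ᴹ x
    -0ᴹ-identityʳ x = ≈ᴹ-trans (+ᴹ-congˡ (≈ᴹ-sym (ModuleProperties.inverseˡ-uniqueᴹ N 0ᴹ 0ᴹ (+ᴹ-identityˡ 0ᴹ))))
      (+ᴹ-identityʳ x)

    -- `x ≈ 0` in `N / M` unfolds to membership of this literal difference, so annihilation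
    -- statements about quotients pass through here.
    -0-∈ : (M : Submodule N) → ∀ {x} → x ∈ M → x +ᴹ -ᴹ 0ᴹ ∈ M
    -0-∈ M {x} = Submodule.resp M (≈ᴹ-sym (-0ᴹ-identityʳ x))

    -0-∈⁻¹ : (M : Submodule N) → ∀ {x} → x +ᴹ -ᴹ 0ᴹ ∈ M → x ∈ M
    -0-∈⁻¹ M {x} = Submodule.resp M (-0ᴹ-identityʳ x)

    -- A preimage of `(x , y)` is `f x + e y`: it differs from `x` by `e (y - x)`, which is in `A`,
    -- and from `y` by `f (x - y)`, which is in `B`. `C` is any submodule with the elements of the
    -- intersection, so that `⋂ M` can stand there as it is.
    crt : (A B C : Submodule N) → C ⊆ A → C ⊆ B → (∀ {x} → x ∈ A → x ∈ B → x ∈ C) →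
          ∀ {e f} → (∀ x → e *ₗ x ∈ A) → (∀ x → f *ₗ x ∈ B) → 1# ≈ e + f →
          (N / C) ≅ (N / A) ⊕ (N / B)
    crt A B C C⊆A C⊆B A∩B⊆C {e} {f} eA fB 1≈e+f = linear-≅ {N = N / C} {(N / A) ⊕ (N / B)}
      (λ x → x , x)
      (λ p → C⊆A p , C⊆B p)
      (λ _ _ → Module.≈ᴹ-refl (N / A) , Module.≈ᴹ-refl (N / B))
      (λ _ _ → Module.≈ᴹ-refl (N / A) , Module.≈ᴹ-refl (N / B))
      (λ (p , q) → A∩B⊆C p q)
      (λ (x , y) → f *ₗ x +ᴹ e *ₗ y , split x y)
      where
      open import Relation.Binary.Reasoning.Setoid ≈ᴹ-setoid
      swap : ∀ {g h} x y → 1# ≈ g + h → (h *ₗ x +ᴹ g *ₗ y) +ᴹ -ᴹ x ≈ᴹ g *ₗ (y +ᴹ -ᴹ x)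
      swap {g} {h} x y 1≈ = begin
        (h *ₗ x +ᴹ g *ₗ y) +ᴹ -ᴹ x                 ≈⟨ +ᴹ-congʳ (+ᴹ-comm _ _) ⟩
        (g *ₗ y +ᴹ h *ₗ x) +ᴹ -ᴹ x                 ≈⟨ +ᴹ-assoc _ _ _ ⟩
        g *ₗ y +ᴹ (h *ₗ x +ᴹ -ᴹ x)                 ≈⟨ +ᴹ-congˡ (ModuleProperties.inverseʳ-uniqueᴹ N _ _ total) ⟩
        g *ₗ y +ᴹ -ᴹ (g *ₗ x)                      ≈⟨ +ᴹ-congˡ (ModuleProperties.inverseʳ-uniqueᴹ N _ _ opposite) ⟨
        g *ₗ y +ᴹ g *ₗ (-ᴹ x)                      ≈⟨ *ₗ-distribˡ g y (-ᴹ x) ⟨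
        g *ₗ (y +ᴹ -ᴹ x)                           ∎
        where
        opposite : g *ₗ x +ᴹ g *ₗ (-ᴹ x) ≈ᴹ 0ᴹ
        opposite = begin
          g *ₗ x +ᴹ g *ₗ (-ᴹ x)  ≈⟨ *ₗ-distribˡ g x (-ᴹ x) ⟨
          g *ₗ (x +ᴹ -ᴹ x)       ≈⟨ *ₗ-congˡ (-ᴹ‿inverseʳ x) ⟩
          g *ₗ 0ᴹ                ≈⟨ *ₗ-zeroʳ g ⟩
          0ᴹ                     ∎
        total : g *ₗ x +ᴹ (h *ₗ x +ᴹ -ᴹ x) ≈ᴹ 0ᴹ
        total = begin
          g *ₗ x +ᴹ (h *ₗ x +ᴹ -ᴹ x)   ≈⟨ +ᴹ-assoc _ _ _ ⟨
          (g *ₗ x +ᴹ h *ₗ x) +ᴹ -ᴹ x   ≈⟨ +ᴹ-congʳ (*ₗ-distribʳ x g h) ⟨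
          (g + h) *ₗ x +ᴹ -ᴹ x         ≈⟨ +ᴹ-congʳ (*ₗ-congʳ 1≈) ⟨
          1# *ₗ x +ᴹ -ᴹ x              ≈⟨ +ᴹ-congʳ (*ₗ-identityˡ x) ⟩
          x +ᴹ -ᴹ x                    ≈⟨ -ᴹ‿inverseʳ x ⟩
          0ᴹ                           ∎

      split : ∀ x y → Module._≈ᴹ_ ((N / A) ⊕ (N / B)) (f *ₗ x +ᴹ e *ₗ y , f *ₗ x +ᴹ e *ₗ y) (x , y)
      split x y =
          Submodule.resp A (≈ᴹ-sym (swap x y 1≈e+f)) (eA (y +ᴹ -ᴹ x))
        , Submodule.resp B (≈ᴹ-sym (≈ᴹ-trans (+ᴹ-congʳ (+ᴹ-comm _ _)) (swap y x (trans 1≈e+f (+-comm e f)))))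
            (fB (x +ᴹ -ᴹ y))

  Kills : Carrier → Module 𝓞 m₁ ℓ₁ → Set _
  Kills r N = ∀ x → r *ₗ x ≈ᴹ 0ᴹ
    where open Module N

  kills-≅ : ∀ {N : Module 𝓞 m₁ ℓ₁} {N′ : Module 𝓞 m₂ ℓ₂} {r} → N ≅ N′ → Kills r N → Kills r N′
  kills-≅ {N = N} {N′} {r} φ kills y = let (x , fx≈y) = onto y in begin
    r *ₗ y        ≈⟨ *ₗ-congˡ fx≈y ⟨
    r *ₗ to x     ≈⟨ *ₗ-homo r x ⟨
    to (r N.*ₗ x) ≈⟨ ⟦⟧-cong (kills x) ⟩
    to N.0ᴹ       ≈⟨ 0ᴹ-homo ⟩
    0ᴹ            ∎
    where
    open Iso {N = N} {N′} φ
    module N = Module N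
    open Module N′
    open import Relation.Binary.Reasoning.Setoid ≈ᴹ-setoid

  kills-≅⁻¹ : ∀ {N : Module 𝓞 m₁ ℓ₁} {N′ : Module 𝓞 m₂ ℓ₂} {r} → N ≅ N′ → Kills r N′ → Kills r N
  kills-≅⁻¹ {N = N} {N′} {r} φ kills x = injective
    (≈ᴹ-trans (*ₗ-homo r x) (≈ᴹ-trans (kills (to x)) (≈ᴹ-sym 0ᴹ-homo)))
    where
    open Iso {N = N} {N′} φ
    open Module N′

  kills-⨁ : ∀ {n r} {N : Fin n → Module 𝓞 m₁ ℓ₁} → (∀ i → Kills r (N i)) → Kills r (⨁ N)
  kills-⨁ {n = zero}  f _       = tt
  kills-⨁ {n = suc n} f (x , y) = f zero x , kills-⨁ (f ∘ suc) y

  kills-⨁⁻¹ : ∀ {n r} (N : Fin n → Module 𝓞 m₁ ℓ₁) → Kills r (⨁ N) → ∀ i → Kills r (N i)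
  kills-⨁⁻¹ N f zero    x = proj₁ (f (x , Module.0ᴹ (⨁ (N ∘ suc))))
  kills-⨁⁻¹ N f (suc i)   = kills-⨁⁻¹ (N ∘ suc) (λ y → proj₂ (f (Module.0ᴹ (N zero) , y))) i

  kills-𝓞/ : ∀ {I : Ideal} {r} → r ∈ I → Kills r (𝓞¹ / I)
  kills-𝓞/ {I} r∈I x = -0-∈ I (*ʳ-closed I x r∈I)

  kills-𝓞/⁻¹ : ∀ {I : Ideal} {r} → Kills r (𝓞¹ / I) → r ∈ I
  kills-𝓞/⁻¹ {I} {r} f = Submodule.resp I (*-identityʳ r) (-0-∈⁻¹ I (f 1#))

-- Invariants of a submodule and of an intersection.

module InvariantTheory {c ℓ} (𝓞 : CommutativeRing c ℓ) where

  open CommutativeRing 𝓞 hiding (zero)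
  open Over 𝓞
  open IdealTheory 𝓞
  open ModuleTheory 𝓞
  open import Algebra.Definitions.RawMagma *-rawMagma using (_,_)
  open import Relation.Binary.Reasoning.Setoid setoid
  open NaturalSolver commutativeSemiring using (solve; _:=_; _:+_; _:*_)

  ∏-cat : ∀ {a} {A : Set a} {m n} (H : A → Ideal) (xs : Vector A m) (ys : Vector A n) →
          ∏ (H ∘ cat xs ys) ≐ ∏ (H ∘ xs) · ∏ (H ∘ ys)
  ∏-cat {m = zero} H xs ys =
      (λ {x} p → Submodule.resp (𝟙 · ∏ (H ∘ ys)) (*-identityˡ x) (·-intro {𝟙} {∏ (H ∘ ys)} tt p))
    , ·⊆ʳ {𝟙} {∏ (H ∘ ys)}
  ∏-cat {m = suc m} H xs ys =
      (λ p → proj₂ assoc (·-mono {X} {X} {∏ (H ∘ cat (xs ∘ suc) ys)} {Y · Z} (λ q → q) (proj₁ IH) p))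
    , (λ p → ·-mono {X} {X} {Y · Z} {∏ (H ∘ cat (xs ∘ suc) ys)} (λ q → q) (proj₂ IH) (proj₁ assoc p))
    where
    X = H (xs zero)
    Y = ∏ (H ∘ xs ∘ suc)
    Z = ∏ (H ∘ ys)
    IH    = ∏-cat H (xs ∘ suc) ys
    assoc = ·-assoc {X} {Y} {Z}

  pairwise-cat : ∀ {a} {A : Set a} {m n} (H : A → Ideal) (xs : Vector A m) (ys : Vector A n) →
    Pairwise (H ∘ xs) → Pairwise (H ∘ ys) → (∀ i j → Coprime (H (xs i)) (H (ys j))) →
    Pairwise (H ∘ cat xs ys)
  pairwise-cat {m = zero}  H xs ys f g h = g
  pairwise-cat {m = suc m} H xs ys f g h = go
    where
    rest : ∀ j → Coprime (H (xs zero)) (H (cat (xs ∘ suc) ys j))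
    rest = cat-all (λ x → Coprime (H (xs zero)) (H x)) (xs ∘ suc) ys (λ j → f zero (suc j) λ ()) (h zero)

    go : Pairwise (H ∘ cat xs ys)
    go zero    zero    0≢0 = contradiction ≡.refl 0≢0
    go zero    (suc j) _   = rest j
    go (suc i) zero    _   = coprime-sym (rest i)
    go (suc i) (suc j) i≢j = pairwise-cat H (xs ∘ suc) ys (pairwise-tail {A = H ∘ xs} f) g
      (h ∘ suc) i j (i≢j ∘ ≡.cong suc)

  -- If the sum of the two ideals were only `A i`, then `A j ⊆ A i`, and maximality of `A j` would
  -- make them equal.
  maximal⇒pairwise : ∀ {n} (A : Fin n → Ideal) → (∀ i → IsMaximal (A i)) →
    (∀ i j → A i ≐ A j → i ≡ j) → Pairwise A
  maximal⇒pairwise A max distinct i j i≢j with proj₂ (max i) (A i +ⁱ A j)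
    (λ {x} p → x , 0# , p , Submodule.0-closed (A j) , sym (+-identityʳ x))
  ... | inj₂ (_ , full) = coprime (full tt)
  ... | inj₁ (⊆Aᵢ , _) with proj₂ (max j) (A i)
    (λ {x} p → ⊆Aᵢ (0# , x , Submodule.0-closed (A i) , p , sym (+-identityˡ x)))
  ...   | inj₁ Aᵢ≐Aⱼ     = contradiction (distinct i j Aᵢ≐Aⱼ) i≢j
  ...   | inj₂ (_ , full) = contradiction (full tt) (proj₁ (max i))

  -- Coprimality is what can be checked across a concatenation; this turns it back into the
  -- distinctness that `Invariants` asks for.
  pairwise⇒distinct : ∀ {n} (A : Fin n → Ideal) → (∀ i → 1# ∉ A i) → Pairwise A →
    ∀ i j → A i ≐ A j → i ≡ j
  pairwise⇒distinct A 1∉A f i j (Aᵢ⊆Aⱼ , _) with i Fin.≟ j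
  ... | yes i≡j = i≡j
  ... | no i≢j with f i j i≢j
  ...   | coprime (x , y , p , q , eq) = contradiction
            (Submodule.resp (A j) (sym eq) (Submodule.+-closed (A j) (Aᵢ⊆Aⱼ p) q)) (1∉A j)

  module Inv {M : Submodule 𝓞²} (inv : Invariants M) where
    open Invariants inv

    𝓜-pairwise : Pairwise 𝓜
    𝓜-pairwise = maximal⇒pairwise 𝓜 maximal distinct

    ^-pairwise : (e : Fin r → ℕ) → Pairwise (λ j → 𝓜 j ^ⁱ e j)
    ^-pairwise e i j i≢j = coprime-^-^ (e i) (e j) (𝓜-pairwise i j i≢j)

    𝓛⊆ : ∀ j → 𝓛 ⊆ 𝓜 j ^ⁱ n j
    𝓛⊆ = ∏⊆ (λ j → 𝓜 j ^ⁱ n j)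

    𝓚⊆ : ∀ j → 𝓚 ⊆ 𝓜 j ^ⁱ k j
    𝓚⊆ = ∏⊆ (λ j → 𝓜 j ^ⁱ k j)

    ^k⊆ : ∀ j → 𝓜 j ^ⁱ k j ⊆ 𝓜 j
    ^k⊆ j with k j | k≢0 j
    ... | zero  | 0≢0 = contradiction ≡.refl 0≢0
    ... | suc e | _   = ·⊆ˡ {𝓜 j} {𝓜 j ^ⁱ e}

    𝓚⊆𝓜 : ∀ j → 𝓚 ⊆ 𝓜 j
    𝓚⊆𝓜 j p = ^k⊆ j (𝓚⊆ j p)

    𝓚⊆𝓛 : 𝓚 ⊆ 𝓛
    𝓚⊆𝓛 = ∏-mono (λ j → ^ⁱ-antitone (𝓜 j) (n≤k j))

    -- Checked one prime power at a time, where the exponents add up to `n j + (k j ∸ n j) = k j`;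
    -- `⋂⊆∏` reassembles the powers.
    𝓛𝓘⊆𝓚 : 𝓛 · 𝓘 ⊆ 𝓚
    𝓛𝓘⊆𝓚 = ·-least {𝓛} {𝓘} {𝓚} λ {x} {y} x∈ y∈ →
      ⋂⊆∏ (λ j → 𝓜 j ^ⁱ k j) (^-pairwise k) λ j →
        ≡.subst (λ e → x * y ∈ 𝓜 j ^ⁱ e) (ℕ.m+[n∸m]≡n (n≤k j))
          (^ⁱ-+ (𝓜 j) (n j) (k j ∸ n j) (𝓛⊆ j x∈) (∏⊆ (λ j → 𝓜 j ^ⁱ (k j ∸ n j)) j y∈))

    block : Fin r → Module 𝓞 c (c ⊔ ℓ)
    block j = (𝓞¹ / (𝓜 j ^ⁱ n j)) ⊕ (𝓞¹ / (𝓜 j ^ⁱ k j))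

    𝓚-kills : ∀ {x} → x ∈ 𝓚 → ∀ v → Module._*ₗ_ 𝓞² x v ∈ M
    𝓚-kills {x} x∈𝓚 v = -0-∈⁻¹ M (kills-≅⁻¹ {N = 𝓞² / M} {⨁ block} decompose
      (kills-⨁ {N = block} λ j (y , z) →
        kills-𝓞/ {𝓜 j ^ⁱ n j} (𝓛⊆ j (𝓚⊆𝓛 x∈𝓚)) y , kills-𝓞/ {𝓜 j ^ⁱ k j} (𝓚⊆ j x∈𝓚) z) v)

    -- The second summand of block `j` has annihilator `𝓜 j ^ⁱ k j`, and these coprime powers
    -- intersect in `𝓚`. Together with `𝓚-kills` this shows that `𝓚` is determined by `M`, whatever
    -- the decomposition.
    kills⇒𝓚 : ∀ {x} → (∀ v → Module._*ₗ_ 𝓞² x v ∈ M) → x ∈ 𝓚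
    kills⇒𝓚 {x} kills = ⋂⊆∏ (λ j → 𝓜 j ^ⁱ k j) (^-pairwise k) λ j →
      kills-𝓞/⁻¹ {𝓜 j ^ⁱ k j} (λ z → proj₂ (kills-⨁⁻¹ block
        (kills-≅ {N = 𝓞² / M} {⨁ block} decompose (λ v → -0-∈ M (kills v))) j (0# , z)))

  -- `IsProjectiveInvariant` with the pair as its own representative and with the decomposition
  -- fixed in advance: the form in which one pair `(a , b)` can be carried through all the
  -- submodules.
  record Represents {M : Submodule 𝓞²} (inv : Invariants M) (a b : Carrier) : Set (c ⊔ ℓ) where
    open Invariants inv
    field
      t       : Carrier
      t∈𝓛     : t ∈ 𝓛
      t∉𝓛𝓜    : ∀ j → t ∉ 𝓛 · 𝓜 j
      ta,tb∈M : (t * a , t * b) ∈ M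

  -- Bézout's identity for (a′ , b′) writes (a , b) as (ua + vb)(a′ , b′) + (ab′ - ba′)(v , -u).
  change-representative : ∀ {M} (inv : Invariants M) {a b a′ b′ s} → ⟨ a′ ⟩ +ⁱ ⟨ b′ ⟩ ≐ 𝟙 →
    s * (a * b′ - b * a′) ∈ Invariants.𝓚 inv → (s * a′ , s * b′) ∈ M → (s * a , s * b) ∈ M
  change-representative {M} inv {a} {b} {a′} {b′} {s} (_ , full) sδ∈𝓚 sa′,sb′∈M with full {1#} tt
  ... | _ , _ , (u , ua′≈) , (v , vb′≈) , eq = M.resp (fst≈ , snd≈)
      (M.+-closed (M.*ₗ-closed (u * a + v * b) sa′,sb′∈M) (Inv.𝓚-kills inv sδ∈𝓚 (v , - u)))
    where
    module M = Submodule M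
    δ = a * b′ - b * a′

    1≈ : 1# ≈ u * a′ + v * b′
    1≈ = trans eq (sym (+-cong ua′≈ vb′≈))

    δ-spec : a * b′ ≈ δ + b * a′
    δ-spec = sym (trans (+-assoc _ _ _) (trans (+-congˡ (-‿inverseˡ (b * a′))) (+-identityʳ _)))

    factor : ∀ m x w → m * (s * x) + (s * δ) * w ≈ s * (m * x + δ * w)
    factor m x w = solve 5 (λ m s x δ w → m :* (s :* x) :+ (s :* δ) :* w := s :* (m :* x :+ δ :* w)) refl m s x δ w

    fst≈ : (u * a + v * b) * (s * a′) + (s * δ) * v ≈ s * a
    fst≈ = trans (factor _ a′ v) (*-congˡ (begin
      (u * a + v * b) * a′ + δ * v
        ≈⟨ solve 5 (λ x v b a′ δ → (x :+ v :* b) :* a′ :+ δ :* v := x :* a′ :+ v :* (δ :+ b :* a′))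
             refl (u * a) v b a′ δ ⟩
      (u * a) * a′ + v * (δ + b * a′)
        ≈⟨ +-congˡ (*-congˡ (sym δ-spec)) ⟩
      (u * a) * a′ + v * (a * b′)
        ≈⟨ solve 5 (λ u a a′ v b′ → (u :* a) :* a′ :+ v :* (a :* b′) := a :* (u :* a′ :+ v :* b′)) refl u a a′ v b′ ⟩
      a * (u * a′ + v * b′)
        ≈⟨ *-congˡ 1≈ ⟨
      a * 1#
        ≈⟨ *-identityʳ a ⟩
      a ∎))

    snd≈ : (u * a + v * b) * (s * b′) + (s * δ) * (- u) ≈ s * b
    snd≈ = trans (factor _ b′ (- u)) (*-congˡ (begin
      (u * a + v * b) * b′ + δ * (- u)
        ≈⟨ solve 5 (λ u a y b′ w → (u :* a :+ y) :* b′ :+ w := (u :* (a :* b′) :+ y :* b′) :+ w)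
             refl u a (v * b) b′ (δ * (- u)) ⟩
      (u * (a * b′) + (v * b) * b′) + δ * (- u)
        ≈⟨ +-congʳ (+-congʳ (*-congˡ δ-spec)) ⟩
      (u * (δ + b * a′) + (v * b) * b′) + δ * (- u)
        ≈⟨ solve 5 (λ u δ x y w → (u :* (δ :+ x) :+ y) :+ δ :* w := (u :* x :+ y) :+ δ :* (u :+ w))
             refl u δ (b * a′) ((v * b) * b′) (- u) ⟩
      (u * (b * a′) + (v * b) * b′) + δ * (u - u)
        ≈⟨ +-cong (solve 5 (λ u b a′ v b′ → u :* (b :* a′) :+ (v :* b) :* b′ := b :* (u :* a′ :+ v :* b′))
             refl u b a′ v b′) (*-congˡ (-‿inverseʳ u)) ⟩
      b * (u * a′ + v * b′) + δ * 0#
        ≈⟨ +-cong (*-congˡ (sym 1≈)) (zeroʳ δ) ⟩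
      b * 1# + 0#
        ≈⟨ trans (+-identityʳ _) (*-identityʳ b) ⟩
      b ∎))

  Triple : Set (Level.suc (c ⊔ ℓ))
  Triple = Ideal × ℕ × ℕ

  -- Opaque, since conversion checking compares modules field by field, which is
  -- intractable for unfolded blocks.
  opaque
    block : Triple → Module 𝓞 c (c ⊔ ℓ)
    block (P , n , k) = (𝓞¹ / (P ^ⁱ n)) ⊕ (𝓞¹ / (P ^ⁱ k))

    fold-block : ∀ P n k → (𝓞¹ / (P ^ⁱ n)) ⊕ (𝓞¹ / (P ^ⁱ k)) ≅ block (P , n , k)
    fold-block P n k = linear-≅ {N = (𝓞¹ / (P ^ⁱ n)) ⊕ (𝓞¹ / (P ^ⁱ k))} {block (P , n , k)}
      (λ x → x) (λ p → p) (λ _ _ → ≈ᴹ-refl) (λ _ _ → ≈ᴹ-refl) (λ p → p) (λ y → y , ≈ᴹ-refl)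
      where open Module (block (P , n , k))

    unfold-block : ∀ t → block t ≅ (𝓞¹ / (proj₁ t ^ⁱ proj₁ (proj₂ t))) ⊕ (𝓞¹ / (proj₁ t ^ⁱ proj₂ (proj₂ t)))
    unfold-block t = linear-≅ {N = block t} {(𝓞¹ / (proj₁ t ^ⁱ proj₁ (proj₂ t))) ⊕ (𝓞¹ / (proj₁ t ^ⁱ proj₂ (proj₂ t)))}
      (λ x → x) (λ p → p) (λ _ _ → ≈ᴹ-refl) (λ _ _ → ≈ᴹ-refl) (λ p → p) (λ y → y , ≈ᴹ-refl)
      where open Module (block t)

  into-blocks : ∀ {M : Submodule 𝓞²} (inv : Invariants M) →
    𝓞² / M ≅ ⨁ (λ j → block (Invariants.𝓜 inv j , Invariants.n inv j , Invariants.k inv j))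
  into-blocks {M} inv = ≅-trans {N = 𝓞² / M} {⨁ (λ j → (𝓞¹ / (𝓜 j ^ⁱ n j)) ⊕ (𝓞¹ / (𝓜 j ^ⁱ k j)))}
    {⨁ (λ j → block (𝓜 j , n j , k j))} decompose (⨁-cong (λ j → fold-block (𝓜 j) (n j) (k j)))
    where open Invariants inv

  module Merge {A B C : Submodule 𝓞²} (C⊆A : C ⊆ A) (C⊆B : C ⊆ B) (A∩B⊆C : ∀ {x} → x ∈ A → x ∈ B → x ∈ C)
    (α : Invariants A) (β : Invariants B)
    (𝓚-coprime : Coprime (Invariants.𝓚 α) (Invariants.𝓚 β)) where

    private
      module α = Invariants α
      module β = Invariants β
      module α′ = Inv α
      module β′ = Inv β

    triplesᵅ : Fin α.r → Triple
    triplesᵅ j = α.𝓜 j , α.n j , α.k j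

    triplesᵝ : Fin β.r → Triple
    triplesᵝ j = β.𝓜 j , β.n j , β.k j

    triples : Fin (α.r ℕ.+ β.r) → Triple
    triples = cat triplesᵅ triplesᵝ

    all : ∀ {p} (P : Triple → Set p) → (∀ j → P (triplesᵅ j)) → (∀ j → P (triplesᵝ j)) → ∀ j → P (triples j)
    all P = cat-all P triplesᵅ triplesᵝ

    maximal : ∀ j → IsMaximal (proj₁ (triples j))
    maximal = all (λ (P , _) → IsMaximal P) α.maximal β.maximal

    -- As no exponent `k j` is zero, each maximal ideal contains its own `𝓚`; coprimality of the two
    -- `𝓚` therefore passes to the mixed pairs.
    pairwise : Pairwise (proj₁ ∘ triples)
    pairwise = pairwise-cat proj₁ triplesᵅ triplesᵝ α′.𝓜-pairwise β′.𝓜-pairwise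
      (λ i j → coprime-mono (α′.𝓚⊆𝓜 i) (β′.𝓚⊆𝓜 j) 𝓚-coprime)

    decompose : 𝓞² / C ≅ ⨁ (λ j → block (triples j))
    decompose = let (e , f , e∈ , f∈ , 1≈e+f) = Coprime.1∈I+J 𝓚-coprime in
      ≅-trans {N = 𝓞² / C} {(𝓞² / A) ⊕ (𝓞² / B)} {⨁ (λ j → block (triples j))}
        (crt A B C C⊆A C⊆B A∩B⊆C (α′.𝓚-kills e∈) (β′.𝓚-kills f∈) 1≈e+f)
        (≅-trans {N = (𝓞² / A) ⊕ (𝓞² / B)} {⨁ (λ j → block (triplesᵅ j)) ⊕ ⨁ (λ j → block (triplesᵝ j))} {⨁ (λ j → block (triples j))}
          (⊕-cong {N = 𝓞² / A} {⨁ (λ j → block (triplesᵅ j))} {𝓞² / B} {⨁ (λ j → block (triplesᵝ j))}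
            (into-blocks α) (into-blocks β))
          (⨁-cat block triplesᵅ triplesᵝ))

    merged : Invariants C
    merged = record
      { r         = α.r ℕ.+ β.r
      ; 𝓜         = λ j → proj₁ (triples j)
      ; maximal   = maximal
      ; distinct  = pairwise⇒distinct (proj₁ ∘ triples) (proj₁ ∘ maximal) pairwise
      ; n         = λ j → proj₁ (proj₂ (triples j))
      ; k         = λ j → proj₂ (proj₂ (triples j))
      ; n≤k       = all (λ (_ , n , k) → n ℕ.≤ k) α.n≤k β.n≤k
      ; k≢0       = all (λ (_ , _ , k) → k ≢ 0) α.k≢0 β.k≢0
      ; decompose = ≅-trans {N = 𝓞² / C} {⨁ (λ j → block (triples j))}
          {⨁ (λ j → (𝓞¹ / (proj₁ (triples j) ^ⁱ proj₁ (proj₂ (triples j))))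
                   ⊕ (𝓞¹ / (proj₁ (triples j) ^ⁱ proj₂ (proj₂ (triples j)))))}
          decompose (⨁-cong (λ j → unfold-block (triples j)))
      }

    open Invariants merged using (𝓛; 𝓚; 𝓘)

    𝓛≐ : 𝓛 ≐ α.𝓛 · β.𝓛
    𝓛≐ = ∏-cat (λ (P , n , _) → P ^ⁱ n) triplesᵅ triplesᵝ

    𝓚≐ : 𝓚 ≐ α.𝓚 · β.𝓚
    𝓚≐ = ∏-cat (λ (P , _ , k) → P ^ⁱ k) triplesᵅ triplesᵝ

    𝓘≐ : 𝓘 ≐ α.𝓘 · β.𝓘
    𝓘≐ = ∏-cat (λ (P , n , k) → P ^ⁱ (k ∸ n)) triplesᵅ triplesᵝ

    -- Squaring 𝓚 makes e and f small enough: 𝓚² ⊆ 𝓛 𝓜ⱼ for every j, even where nⱼ = kⱼ.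
    represents : ∀ {a b} → Represents α a b → Represents β a b → Represents merged a b
    represents {a} {b} ρ σ = combine
      (coprime-· (coprime-sym (coprime-· 𝓚-coprime 𝓚-coprime)) (coprime-sym (coprime-· 𝓚-coprime 𝓚-coprime)))
      where
      module ρ = Represents ρ
      module σ = Represents σ

      -- Modulo `X` the coefficient `h` is 0 and `g` is 1, so `g x + h y` is congruent to `x`. If
      -- the merged witness fell into `𝓛 · P`, one of the original witnesses would fall into its own
      -- forbidden ideal.
      isolate : ∀ (X : Ideal) {g h x y} → 1# ≈ g + h → h ∈ X → g * x + h * y ∈ X → x ∈ X
      isolate X {g} {h} {x} {y} 1≈g+h h∈ p = Submodule.resp X (begin
        g * x + h * x  ≈⟨ distribʳ x g h ⟨
        (g + h) * x    ≈⟨ *-congʳ 1≈g+h ⟨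
        1# * x         ≈⟨ *-identityˡ x ⟩
        x              ∎)
        (Submodule.+-closed X (+-cancelʳ-∈ X p (*ʳ-closed X y h∈)) (*ʳ-closed X x h∈))

      combine : Coprime (β.𝓚 · β.𝓚) (α.𝓚 · α.𝓚) → Represents merged a b
      combine (coprime (f , e , f∈ , e∈ , 1≈f+e)) = record
        { t       = f * ρ.t + e * σ.t
        ; t∈𝓛     = proj₂ 𝓛≐ (Submodule.+-closed (α.𝓛 · β.𝓛)
            (Submodule.resp (α.𝓛 · β.𝓛) (*-comm ρ.t f) (·-intro {α.𝓛} {β.𝓛} ρ.t∈𝓛 (β′.𝓚⊆𝓛 f∈𝓚)))
            (·-intro {α.𝓛} {β.𝓛} (α′.𝓚⊆𝓛 e∈𝓚) σ.t∈𝓛))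
        ; t∉𝓛𝓜    = all (λ (P , _) → f * ρ.t + e * σ.t ∉ 𝓛 · P)
            (λ j p → ρ.t∉𝓛𝓜 j (isolate (α.𝓛 · α.𝓜 j) 1≈f+e
              (·-mono {α.𝓚} {α.𝓛} {α.𝓚} {α.𝓜 j} α′.𝓚⊆𝓛 (α′.𝓚⊆𝓜 j) e∈)
              (·-mono {𝓛} {α.𝓛} {α.𝓜 j} {α.𝓜 j} (λ q → ·⊆ˡ {α.𝓛} {β.𝓛} (proj₁ 𝓛≐ q)) (λ q → q) p)))
            (λ j p → σ.t∉𝓛𝓜 j (isolate (β.𝓛 · β.𝓜 j) (trans 1≈f+e (+-comm f e))
              (·-mono {β.𝓚} {β.𝓛} {β.𝓚} {β.𝓜 j} β′.𝓚⊆𝓛 (β′.𝓚⊆𝓜 j) f∈)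
              (Submodule.resp (β.𝓛 · β.𝓜 j) (+-comm _ _)
                (·-mono {𝓛} {β.𝓛} {β.𝓜 j} {β.𝓜 j} (λ q → ·⊆ʳ {α.𝓛} {β.𝓛} (proj₁ 𝓛≐ q)) (λ q → q) p))))
        ; ta,tb∈M = A∩B⊆C
            (Submodule.resp A (regroup a , regroup b) (Submodule.+-closed A
              (Submodule.*ₗ-closed A f ρ.ta,tb∈M) (α′.𝓚-kills e∈𝓚 (σ.t * a , σ.t * b))))
            (Submodule.resp B (regroup a , regroup b) (Submodule.+-closed B
              (β′.𝓚-kills f∈𝓚 (ρ.t * a , ρ.t * b)) (Submodule.*ₗ-closed B e σ.ta,tb∈M)))
        }
        where
        e∈𝓚 : e ∈ α.𝓚
        e∈𝓚 = ·⊆ˡ {α.𝓚} {α.𝓚} e∈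

        f∈𝓚 : f ∈ β.𝓚
        f∈𝓚 = ·⊆ˡ {β.𝓚} {β.𝓚} f∈

        regroup : ∀ x → f * (ρ.t * x) + e * (σ.t * x) ≈ (f * ρ.t + e * σ.t) * x
        regroup x = solve 5 (λ f t e t′ x → f :* (t :* x) :+ e :* (t′ :* x) := (f :* t :+ e :* t′) :* x)
          refl f ρ.t e σ.t x

  -- What the induction on `l` carries. `represents` is part of it because the witness has to refer
  -- to the very decomposition that is being built.
  record Intersection {l} {M : Fin l → Submodule 𝓞²} (inv : ∀ i → Invariants (M i)) : Set (Level.suc (c ⊔ ℓ)) where
    field
      invariants : Invariants (⋂ M)
    open Invariants invariants
    field
      𝓛≐         : 𝓛 ≐ ∏ (λ i → Invariants.𝓛 (inv i))
      𝓚≐         : 𝓚 ≐ ∏ (λ i → Invariants.𝓚 (inv i))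
      𝓘≐         : 𝓘 ≐ ∏ (λ i → Invariants.𝓘 (inv i))
      represents : ∀ {a b} → (∀ i → Represents (inv i) a b) → Represents invariants a b

  intersection : ∀ {l} {M : Fin l → Submodule 𝓞²} (inv : ∀ i → Invariants (M i)) →
    Pairwise (λ i → Invariants.𝓚 (inv i)) → Intersection inv
  -- The empty intersection is all of `𝓞²` and its quotient is zero. All products are empty, so `1#`
  -- is a witness for every pair.
  intersection {zero} {M} inv _ = record
    { invariants = record
      { r         = 0
      ; 𝓜         = λ ()
      ; maximal   = λ ()
      ; distinct  = λ ()
      ; n         = λ ()
      ; k         = λ ()
      ; n≤k       = λ ()
      ; k≢0       = λ ()
      ; decompose = linear-≅ {N = 𝓞² / ⋂ M} {⨁ {0} (λ ())}
          (λ _ → tt) (λ _ → tt) (λ _ _ → tt) (λ _ _ → tt) (λ _ ()) (λ _ → Module.0ᴹ 𝓞² , tt)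
      }
    ; 𝓛≐         = (λ p → p) , (λ p → p)
    ; 𝓚≐         = (λ p → p) , (λ p → p)
    ; 𝓘≐         = (λ p → p) , (λ p → p)
    ; represents = λ _ → record { t = 1# ; t∈𝓛 = tt ; t∉𝓛𝓜 = λ () ; ta,tb∈M = λ () }
    }
  intersection {suc l} {M} inv pairwise = record
    { invariants = merged
    ; 𝓛≐         = assemble Invariants.𝓛 (𝓛≐) IH.𝓛≐
    ; 𝓚≐         = assemble Invariants.𝓚 (𝓚≐) IH.𝓚≐
    ; 𝓘≐         = assemble Invariants.𝓘 (𝓘≐) IH.𝓘≐
    ; represents = λ ρ → represents (ρ zero) (IH.represents (ρ ∘ suc))
    }
    where
    module IH = Intersection (intersection {M = M ∘ suc} (inv ∘ suc)
                  (pairwise-tail {A = λ i → Invariants.𝓚 (inv i)} pairwise))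

    both : ∀ {x} → x ∈ M zero → x ∈ ⋂ (M ∘ suc) → x ∈ ⋂ M
    both p q zero    = p
    both p q (suc i) = q i

    open Merge {M zero} {⋂ (M ∘ suc)} {⋂ M} (λ p → p zero) (λ p → p ∘ suc)
      both (inv zero) IH.invariants
      (coprime-mono (λ p → p) (proj₂ IH.𝓚≐) (coprime-∏ (λ i → pairwise zero (suc i) λ ())))

    assemble : (F : ∀ {M} → Invariants M → Ideal) → F merged ≐ F (inv zero) · F IH.invariants →
      F IH.invariants ≐ ∏ (λ i → F (inv (suc i))) → F merged ≐ ∏ (λ i → F (inv i))
    assemble F (f , f′) g = (λ p → proj₁ tail (f p)) , (λ p → f′ (proj₂ tail p))
      where
      tail = ·-cong {F (inv zero)} {F (inv zero)} {F IH.invariants} {∏ (λ i → F (inv (suc i)))}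
        ((λ p → p) , (λ p → p)) g

-- Valuations at the maximal ideals of a Dedekind domain.

module DedekindTheory {c ℓ} (em : ExcludedMiddle (Level.suc (c ⊔ ℓ)))
  (𝓞 : CommutativeRing c ℓ) (dedekind : Over.IsDedekindDomain 𝓞) where

  open CommutativeRing 𝓞 hiding (zero)
  open Over 𝓞
  open IsDedekindDomain dedekind
  open IdealTheory 𝓞
  open import Algebra.Definitions.RawMagma *-rawMagma using (_,_; _∣_)
  open import Algebra.Properties.Semiring.Exp semiring using (_^_; ^-homo-*)
  open import Algebra.Properties.Semiring.Sum semiring using (sum; *-distribˡ-sum; sum-cong-≋)
  open import Algebra.Properties.Ring ring using (-1*x≈-x; x[y-z]≈xy-xz; x∙y⁻¹≈ε⇒x≈y)
  open import Relation.Binary.Reasoning.Setoid setoid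
  open NaturalSolver commutativeSemiring using (solve; _:=_; _:+_; _:*_)

  decide : (P : Set (c ⊔ ℓ)) → Dec P
  decide P = map′ lower lift (em {Lift (Level.suc (c ⊔ ℓ)) P})

  *-cancelˡ : ∀ {x y z} → x ≉ 0# → x * y ≈ x * z → y ≈ z
  *-cancelˡ {x} {y} {z} x≉0 eq with proj₂ isIntegralDomain x (y - z)
    (trans (x[y-z]≈xy-xz x y z) (trans (+-congʳ eq) (-‿inverseʳ (x * z))))
  ... | inj₁ x≈0   = contradiction x≈0 x≉0
  ... | inj₂ y-z≈0 = x∙y⁻¹≈ε⇒x≈y y z y-z≈0

  *-cancelʳ : ∀ {x y z} → x ≉ 0# → y * x ≈ z * x → y ≈ z
  *-cancelʳ {x} {y} {z} x≉0 eq = *-cancelˡ x≉0 (trans (*-comm x y) (trans eq (*-comm z x)))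

  *-≉0 : ∀ {x y} → x ≉ 0# → y ≉ 0# → x * y ≉ 0#
  *-≉0 x≉0 y≉0 xy≈0 with proj₂ isIntegralDomain _ _ xy≈0
  ... | inj₁ p = x≉0 p
  ... | inj₂ p = y≉0 p

  ^-≉0 : ∀ {x} n → x ≉ 0# → x ^ n ≉ 0#
  ^-≉0 zero    x≉0 = proj₁ isIntegralDomain
  ^-≉0 (suc n) x≉0 = *-≉0 x≉0 (^-≉0 n x≉0)

  -- The chain moves to a strictly larger ideal whenever there is one and stays put otherwise, so at
  -- the index where it stabilises nothing larger exists.
  maximal-member : {A : Set (c ⊔ ℓ)} (Φ : A → Ideal) → A →
                   ∃[ a ] (∀ b → Φ a ⊆ Φ b → Φ b ⊆ Φ a)
  maximal-member {A} Φ a₀ = chain m , maximal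
    where
    Larger : A → Set (c ⊔ ℓ)
    Larger a = ∃[ b ] (Φ a ⊆ Φ b × ¬ (Φ b ⊆ Φ a))

    next : ∀ {a} → Dec (Larger a) → A
    next     (yes (b , _)) = b
    next {a} (no _)        = a

    next-⊆ : ∀ {a} (d : Dec (Larger a)) → Φ a ⊆ Φ (next d)
    next-⊆ (yes (_ , a⊆b , _)) = a⊆b
    next-⊆ (no _)              = λ p → p

    chain : ℕ → A
    chain zero    = a₀
    chain (suc n) = next (decide (Larger (chain n)))

    stable : ∃[ m ] (∀ n → m ℕ.≤ n → Φ (chain n) ≐ Φ (chain m))
    stable = isNoetherian (Φ ∘ chain) (λ n → next-⊆ (decide (Larger (chain n))))

    m = proj₁ stable

    maximal : ∀ b → Φ (chain m) ⊆ Φ b → Φ b ⊆ Φ (chain m)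
    maximal b a⊆b with decide (Larger (chain m)) | proj₂ stable (suc m) (ℕ.n≤1+n m)
    ... | yes (_ , _ , b′⊈a) | b′⊆a , _ = contradiction (λ {x} → b′⊆a {x}) b′⊈a
    ... | no ¬larger         | _        =
      decidable-stable (decide (Φ b ⊆ Φ (chain m))) (λ b⊈a → ¬larger (b , a⊆b , b⊈a))

  -- With x = y / a, the elements c 0 , c 1 , … are xⁿ a; that the ideals they
  -- generate stabilise is an integral equation for x.
  module Integrality (a y : Carrier) (a≉0 : a ≉ 0#) (c : ℕ → Carrier) (c₀≈a : c 0 ≈ a)
    (step : ∀ n → c (suc n) * a ≈ c n * y) where

    -- Generated by the `n` elements `c k`, `c (k + 1)`, up to `c (k + n - 1)`. The movable start
    -- `k` is what the induction in `expansion` runs on.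
    J : ℕ → ℕ → Ideal
    J zero    k = ⟨ 0# ⟩
    J (suc n) k = ⟨ c k ⟩ +ⁱ J n (suc k)

    J-mono : ∀ n k → J n k ⊆ J (suc n) k
    J-mono zero    k (r , eq) =
      0# , 0# , (0# , zeroˡ (c k)) , (0# , zeroˡ 0#) ,
      trans (sym eq) (trans (zeroʳ r) (sym (+-identityʳ 0#)))
    J-mono (suc n) k (u , v , u∈ , v∈ , eq) = u , v , u∈ , J-mono n (suc k) v∈ , eq

    c∈J : ∀ n k → c (n ℕ.+ k) ∈ J (suc n) k
    c∈J zero    k = c k , 0# , (1# , *-identityˡ (c k)) , (0# , zeroˡ 0#) , sym (+-identityʳ (c k))
    c∈J (suc n) k = 0# , c (suc n ℕ.+ k) , (0# , zeroˡ (c k)) ,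
      ≡.subst (λ m → c m ∈ J (suc n) (suc k)) (ℕ.+-suc n k) (c∈J n (suc k)) ,
      sym (+-identityˡ _)

    term : ∀ n → Vector Carrier n → Vector Carrier n
    term n s i = s i * (y ^ toℕ i * a ^ (n ∸ toℕ i))

    -- By `step`, `a ^ i * c (k + i)` equals `y ^ i * c k`. Multiplication by `a ^ n` thus turns a
    -- combination of the generators into a multiple of `c k`, whose coefficient has the homogeneous
    -- shape required by `IsIntegrallyClosed`.
    expansion : ∀ n k {x} → x ∈ J n k → Σ[ s ∈ Vector Carrier n ] sum (term n s) * c k ≈ a ^ n * x
    expansion zero    k {x} (r , eq) = (λ ()) , (begin
      0# * c k ≈⟨ zeroˡ (c k) ⟩
      0#       ≈⟨ zeroʳ r ⟨
      r * 0#   ≈⟨ eq ⟩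
      x        ≈⟨ *-identityˡ x ⟨
      1# * x   ∎)
    expansion (suc n) k {x} (u , v , (r , rc≈u) , v∈ , eq) with expansion n (suc k) v∈
    ... | s , IH = r ∷ s , (begin
      (r * (1# * (a * a ^ n)) + sum (λ i → term (suc n) (r ∷ s) (suc i))) * c k
        ≈⟨ *-congʳ (+-congˡ (sum-cong-≋ (λ i →
             solve 4 (λ s y u v → s :* ((y :* u) :* v) := y :* (s :* (u :* v))) refl
               (s i) y (y ^ toℕ i) (a ^ (n ∸ toℕ i))))) ⟩
      (r * (1# * (a * a ^ n)) + sum (λ i → y * term n s i)) * c k
        ≈⟨ *-congʳ (+-cong (*-congˡ (*-identityˡ _)) (sym (*-distribˡ-sum y (term n s)))) ⟩
      (r * (a * a ^ n) + y * sum (term n s)) * c k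
        ≈⟨ solve 6 (λ r a e y t c → (r :* (a :* e) :+ y :* t) :* c := (a :* e) :* (r :* c) :+ t :* (c :* y))
             refl r a (a ^ n) y (sum (term n s)) (c k) ⟩
      (a * a ^ n) * (r * c k) + sum (term n s) * (c k * y)
        ≈⟨ +-cong (*-congˡ rc≈u) (*-congˡ (sym (step k))) ⟩
      (a * a ^ n) * u + sum (term n s) * (c (suc k) * a)
        ≈⟨ +-congˡ (sym (*-assoc _ _ _)) ⟩
      (a * a ^ n) * u + (sum (term n s) * c (suc k)) * a
        ≈⟨ +-congˡ (*-congʳ IH) ⟩
      (a * a ^ n) * u + (a ^ n * v) * a
        ≈⟨ solve 4 (λ a e u v → (a :* e) :* u :+ (e :* v) :* a := (a :* e) :* (u :+ v)) refl a (a ^ n) u v ⟩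
      (a * a ^ n) * (u + v)
        ≈⟨ *-congˡ eq ⟨
      (a * a ^ n) * x ∎)

    power : ∀ n → a ^ n * c n ≈ y ^ n * a
    power zero    = *-congˡ c₀≈a
    power (suc n) = begin
      (a * a ^ n) * c (suc n) ≈⟨ solve 3 (λ a e c → (a :* e) :* c := e :* (c :* a)) refl a (a ^ n) (c (suc n)) ⟩
      a ^ n * (c (suc n) * a) ≈⟨ *-congˡ (step n) ⟩
      a ^ n * (c n * y)       ≈⟨ solve 3 (λ e c y → e :* (c :* y) := y :* (e :* c)) refl (a ^ n) (c n) y ⟩
      y * (a ^ n * c n)       ≈⟨ *-congˡ (power n) ⟩
      y * (y ^ n * a)         ≈⟨ *-assoc _ _ _ ⟨
      (y * y ^ n) * a         ∎

    integral : a ∣ y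
    integral with isNoetherian (λ n → J n 0) (λ n → J-mono n 0)
    -- Stability puts `c m` into the ideal of the `c i` with `i < m`. This is the monic equation of
    -- degree `m` for `y / a`, up to a common factor `a`.
    ... | m , stable with expansion m 0 (proj₁ (stable (suc m) (ℕ.n≤1+n m))
                            (≡.subst (λ k → c k ∈ J (suc m) 0) (ℕ.+-identityʳ m) (c∈J m 0)))
    ...   | s , eq = isIntegrallyClosed m (λ i → (- 1#) * s i) y a a≉0 (begin
      y ^ m + sum (λ i → (- 1# * s i) * (y ^ toℕ i * a ^ (m ∸ toℕ i)))
        ≈⟨ +-congˡ (sum-cong-≋ (λ i → *-assoc (- 1#) (s i) _)) ⟩
      y ^ m + sum (λ i → - 1# * term m s i)
        ≈⟨ +-congˡ (*-distribˡ-sum (- 1#) (term m s)) ⟨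
      y ^ m + - 1# * sum (term m s)
        ≈⟨ +-congˡ (-1*x≈-x _) ⟩
      y ^ m - sum (term m s)
        ≈⟨ +-congˡ (-‿cong (*-cancelʳ a≉0 (begin
             sum (term m s) * a   ≈⟨ *-congˡ c₀≈a ⟨
             sum (term m s) * c 0 ≈⟨ eq ⟩
             a ^ m * c m          ≈⟨ power m ⟩
             y ^ m * a            ∎))) ⟩
      y ^ m - y ^ m
        ≈⟨ -‿inverseʳ (y ^ m) ⟩
      0# ∎)

  ⊈⇒∃ : ∀ {I P : Ideal} → ¬ (I ⊆ P) → ∃[ w ] (w ∈ I × w ∉ P)
  ⊈⇒∃ {I} {P} I⊈P = decidable-stable (decide _) λ none →
    I⊈P (λ {x} x∈I → decidable-stable (decide (x ∈ P)) (λ x∉P → none (x , x∈I , x∉P)))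

  module _ (P : Ideal) (max : IsMaximal P) where

    private
      module P = Submodule P

    -- Among the ideals (a : y) contained in P a maximal one is prime.
    associated : ∀ {a} → a ∈ P → a ≉ 0# → ∃[ y ] (⟨ a ⟩ ∶ y) ≐ P
    associated {a} a∈P a≉0 = y , conclude
      where
      Φ : Σ[ y ∈ Carrier ] (⟨ a ⟩ ∶ y) ⊆ P → Ideal
      Φ (y , _) = ⟨ a ⟩ ∶ y

      -- The start is `y = 1#`, where (a : y) is `⟨ a ⟩`. Only ideals inside `P` compete, so that
      -- the prime obtained is `P` and no other.
      largest = maximal-member Φ (1# , λ {x} (r , eq) →
        P.resp (trans eq (*-identityʳ x)) (P.*ₗ-closed r a∈P))
      y       = proj₁ (proj₁ largest)
      Q       = ⟨ a ⟩ ∶ y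

      Q⊆P : Q ⊆ P
      Q⊆P = proj₂ (proj₁ largest)

      above : ∀ z → Q ⊆ (⟨ a ⟩ ∶ z) → (⟨ a ⟩ ∶ z) ⊆ P → (⟨ a ⟩ ∶ z) ⊆ Q
      above z Q⊆ ⊆P = proj₂ largest (z , ⊆P) Q⊆

      Q⊆Q∶* : ∀ w → Q ⊆ (⟨ a ⟩ ∶ (w * y))
      Q⊆Q∶* w {x} (r , eq) = w * r , (begin
        (w * r) * a  ≈⟨ *-assoc w r a ⟩
        w * (r * a)  ≈⟨ *-congˡ eq ⟩
        w * (x * y)  ≈⟨ solve 3 (λ w x y → w :* (x :* y) := x :* (w :* y)) refl w x y ⟩
        x * (w * y)  ∎)

      prime : IsPrime Q
      prime = (λ 1∈Q → proj₁ max (Q⊆P 1∈Q)) , split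
        where
        split : ∀ x z → x * z ∈ Q → x ∈ Q ⊎ z ∈ Q
        -- If (a : xy) lies in `P`, maximality collapses it to `Q`, and it contains `z`. Otherwise
        -- some `w ∉ P` has `w x y ∈ ⟨ a ⟩`; then (a : wy) contains `x` and lies in `P` by primality
        -- of `P`, so it collapses to `Q` instead.
        split x z (r , eq) with decide ((⟨ a ⟩ ∶ (x * y)) ⊆ P)
        ... | yes ⊆P = inj₂ (above (x * y) (Q⊆Q∶* x) ⊆P
                (r , trans eq (solve 3 (λ x z y → (x :* z) :* y := z :* (x :* y)) refl x z y)))
        ... | no ⊈P with ⊈⇒∃ {⟨ a ⟩ ∶ (x * y)} {P} ⊈P
        ...   | w , (r′ , eq′) , w∉P = inj₁ (above (w * y) (Q⊆Q∶* w)
                  (λ {v} (q , e) → maximal-prime {P} max w∉P (Q⊆P (q , trans e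
                    (solve 3 (λ v w y → v :* (w :* y) := (w :* v) :* y) refl v w y))))
                  (r′ , trans eq′ (solve 3 (λ x w y → w :* (x :* y) := x :* (w :* y)) refl x w y)))

      conclude : Q ≐ P
      conclude with proj₂ (nonzeroPrimeMaximal Q prime (a , (y , *-comm y a) , a≉0)) P Q⊆P
      ... | inj₁ (P⊆Q , _) = Q⊆P , P⊆Q
      ... | inj₂ (_ , full) = contradiction (full tt) (proj₁ max)

    -- p generates P after inverting s, which is a unit at P.
    record Uniformizer : Set (c ⊔ ℓ) where
      field
        p s     : Carrier
        p∈P     : p ∈ P
        s∉P     : s ∉ P
        divides : ∀ {q} → q ∈ P → p ∣ s * q

    -- The candidate is `p = s a / y`: for `q ∈ P` there is `r` with `q y = r a`, and cancelling `a`
    -- gives `r p = s q`. If there is no candidate in `P` with `s ∉ P`, multiplication by `y / a`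
    -- maps `P` into itself; integrality then gives `a ∣ y`, that is, `1# ∈ P`.
    uniformizer : ∀ {a} → a ∈ P → a ≉ 0# → Uniformizer
    uniformizer {a} a∈P a≉0 with associated a∈P a≉0
    ... | y , Q⊆P , P⊆Q with decide (∃[ p ] ∃[ s ] p ∈ P × s ∉ P × s * a ≈ p * y)
    ...   | yes (p , s , p∈P , s∉P , sa≈py) = record
      { p = p ; s = s ; p∈P = p∈P ; s∉P = s∉P
      ; divides = λ {q} q∈P → let (r , ra≈qy) = P⊆Q q∈P in r , *-cancelʳ a≉0 (begin
          (r * p) * a  ≈⟨ solve 3 (λ r p a → (r :* p) :* a := p :* (r :* a)) refl r p a ⟩
          p * (r * a)  ≈⟨ *-congˡ ra≈qy ⟩
          p * (q * y)  ≈⟨ solve 3 (λ p q y → p :* (q :* y) := q :* (p :* y)) refl p q y ⟩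
          q * (p * y)  ≈⟨ *-congˡ sa≈py ⟨
          q * (s * a)  ≈⟨ solve 3 (λ s q a → q :* (s :* a) := (s :* q) :* a) refl s q a ⟩
          (s * q) * a  ∎)
      }
    ...   | no none = contradiction (Q⊆P (let (r , eq) = integral in r , trans eq (sym (*-identityˡ y))))
                        (proj₁ max)
      where
      -- If `x y = r a` had `r ∉ P`, then `x` and `r` would serve as `p` and `s`. So `r` is again in
      -- `P`, and the division can be iterated from `a`.
      next : Σ[ x ∈ Carrier ] x ∈ P → Σ[ x ∈ Carrier ] x ∈ P
      next (x , x∈P) with P⊆Q x∈P
      ... | r , eq = r , decidable-stable (decide (r ∈ P)) (λ r∉P → none (x , r , x∈P , r∉P , eq))

      seq : ℕ → Σ[ x ∈ Carrier ] x ∈ P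
      seq zero    = a , a∈P
      seq (suc n) = next (seq n)

      next-eq : ∀ u → proj₁ (next u) * a ≈ proj₁ u * y
      next-eq (x , x∈P) with P⊆Q x∈P
      ... | r , eq = eq

      open Integrality a y a≉0 (proj₁ ∘ seq) refl (λ n → next-eq (seq n)) using (integral)

    ^-∉ : ∀ {x} n → x ∉ P → x ^ n ∉ P
    ^-∉ zero    x∉P = proj₁ max
    ^-∉ (suc n) x∉P = λ p → ^-∉ n x∉P (maximal-prime {P} max x∉P p)

    -- `⟨ u ⟩` is coprime to `P`, hence to its powers, so `u` is invertible modulo `P ^ⁱ n`.
    unit-cancel : ∀ n {u x} → u ∉ P → u * x ∈ P ^ⁱ n → x ∈ P ^ⁱ n
    unit-cancel n {u} {x} u∉P ux∈
      with coprime-^ n (maximal-coprime max {⟨ u ⟩} (1# , *-identityˡ u) u∉P)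
    ... | coprime (w , q , (e , eu≈w) , q∈ , eq) = Pⁿ.resp (begin
        e * (u * x) + x * q ≈⟨ solve 4 (λ e u x q → e :* (u :* x) :+ x :* q := x :* (e :* u :+ q)) refl e u x q ⟩
        x * (e * u + q)     ≈⟨ *-congˡ (+-congʳ eu≈w) ⟩
        x * (w + q)         ≈⟨ *-congˡ eq ⟨
        x * 1#              ≈⟨ *-identityʳ x ⟩
        x                   ∎) (Pⁿ.+-closed (Pⁿ.*ₗ-closed e ux∈) (Pⁿ.*ₗ-closed x q∈))
      where module Pⁿ = Submodule (P ^ⁱ n)

    module _ (uniformizer : Uniformizer) where
      open Uniformizer uniformizer

      ^-divides : ∀ n {q} → q ∈ P ^ⁱ n → p ^ n ∣ s ^ n * q
      ^-divides zero    {q} _ = q , trans (*-identityʳ q) (sym (*-identityˡ q))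
      ^-divides (suc n) {q} q∈ = Submodule.resp ⟨ p ^ suc n ⟩ (*-comm q _)
        (·-least {P} {P ^ⁱ n} {⟨ p ^ suc n ⟩ ∶ (s ^ suc n)} go q∈)
        where
        go : ∀ {x z} → x ∈ P → z ∈ P ^ⁱ n → p ^ suc n ∣ (x * z) * s ^ suc n
        go {x} {z} x∈ z∈ with divides x∈ | ^-divides n z∈
        ... | r , eq | r′ , eq′ = r * r′ , (begin
          (r * r′) * (p * p ^ n)     ≈⟨ solve 4 (λ r r′ p q → (r :* r′) :* (p :* q) := (r :* p) :* (r′ :* q)) refl r r′ p (p ^ n) ⟩
          (r * p) * (r′ * p ^ n)     ≈⟨ *-cong eq eq′ ⟩
          (s * x) * (s ^ n * z)      ≈⟨ solve 4 (λ s x t z → (s :* x) :* (t :* z) := (x :* z) :* (s :* t)) refl s x (s ^ n) z ⟩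
          (x * z) * (s * s ^ n)      ∎)

      p≉0 : ∀ {a} → a ∈ P → a ≉ 0# → p ≉ 0#
      p≉0 {a} a∈P a≉0 p≈0 with divides a∈P
      ... | r , eq with proj₂ isIntegralDomain s a (trans (sym eq) (trans (*-congˡ p≈0) (zeroʳ r)))
      ...   | inj₁ s≈0 = s∉P (P.resp (sym s≈0) P.0-closed)
      ...   | inj₂ a≈0 = a≉0 a≈0

      -- Write `s ^ (n + d) * x * p ^ d` as a multiple of `p ^ (n + d)`, cancel `p ^ d` in the
      -- domain, then the local unit `s ^ (n + d)`.
      uniformizer-cancel : p ≉ 0# → ∀ n d {x} → x * p ^ d ∈ P ^ⁱ (n ℕ.+ d) → x ∈ P ^ⁱ n
      uniformizer-cancel p≉0 n d {x} xpᵈ∈ with ^-divides (n ℕ.+ d) xpᵈ∈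
      ... | r , eq = unit-cancel n (^-∉ (n ℕ.+ d) s∉P)
        (Submodule.resp (P ^ⁱ n) (*-cancelʳ (^-≉0 d p≉0) (begin
          (r * p ^ n) * p ^ d          ≈⟨ *-assoc _ _ _ ⟩
          r * (p ^ n * p ^ d)          ≈⟨ *-congˡ (^-homo-* p n d) ⟨
          r * p ^ (n ℕ.+ d)            ≈⟨ eq ⟩
          s ^ (n ℕ.+ d) * (x * p ^ d)  ≈⟨ *-assoc _ _ _ ⟨
          (s ^ (n ℕ.+ d) * x) * p ^ d  ∎))
        (Submodule.*ₗ-closed (P ^ⁱ n) r (^-mono-∈ n p∈P)))

      -- Up to powers of `s`, `t` is `r p ^ n` and `x` is `r′ p ^ n`. That `t` has order exactly `n`
      -- means `r ∉ P`, so `x` becomes a multiple of `t` after multiplication by the local unit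
      -- `r s ^ n`.
      local-generator : ∀ n {t x} → t ∈ P ^ⁱ n → t ∉ P ^ⁱ suc n → x ∈ P ^ⁱ n →
                        ∃[ u ] (u ∉ P × t ∣ u * x)
      local-generator n {t} {x} t∈ t∉ x∈ with ^-divides n t∈ | ^-divides n x∈
      ... | r , eq | r′ , eq′ = r * s ^ n , (λ p → ^-∉ n s∉P (maximal-prime {P} max r∉P p)) , r′ * s ^ n , (begin
          (r′ * s ^ n) * t      ≈⟨ *-assoc _ _ _ ⟩
          r′ * (s ^ n * t)      ≈⟨ *-congˡ eq ⟨
          r′ * (r * p ^ n)      ≈⟨ solve 3 (λ r′ r q → r′ :* (r :* q) := r :* (r′ :* q)) refl r′ r (p ^ n) ⟩
          r * (r′ * p ^ n)      ≈⟨ *-congˡ eq′ ⟩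
          r * (s ^ n * x)       ≈⟨ *-assoc _ _ _ ⟨
          (r * s ^ n) * x       ∎)
        where
        r∉P : r ∉ P
        r∉P r∈P = t∉ (unit-cancel (suc n) (^-∉ n s∉P) (Submodule.resp (P ^ⁱ suc n) eq
          (·-intro {P} {P ^ⁱ n} r∈P (^-mono-∈ {P} n p∈P))))

-- Co-torsion submodules: annihilators, rank, localisation at the `𝓜 j`.

module IntersectionTheory {c ℓ} (em : ExcludedMiddle (Level.suc (c ⊔ ℓ)))
  (𝓞 : CommutativeRing c ℓ) (dedekind : Over.IsDedekindDomain 𝓞) where

  open CommutativeRing 𝓞 hiding (zero)
  open Over 𝓞
  open IdealTheory 𝓞
  open DedekindTheory em 𝓞 dedekind
  open InvariantTheory 𝓞
  open IsDedekindDomain dedekind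
  open import Algebra.Definitions.RawMagma *-rawMagma using (_,_)
  open import Algebra.Properties.Semiring.Exp semiring using (_^_)
  open import Algebra.Properties.Ring ring using (-‿distribˡ-*)
  open import Algebra.Properties.CommutativeSemigroup *-commutativeSemigroup using (x∙yz≈y∙xz)
  open import Relation.Binary.Reasoning.Setoid setoid
  open NaturalSolver commutativeSemiring using (solve; _:=_; _:+_; _:*_)
  open Module 𝓞² using (_*ₗ_)
  open ModuleTheory 𝓞 using (-0-∈; -0-∈⁻¹)

  Annihilator : Submodule 𝓞² → Carrier → Set (c ⊔ ℓ)
  Annihilator M d = ∀ v → d *ₗ v ∈ M

  -- Torsion gives an annihilator element by element; multiplying those of the two standard basis
  -- vectors makes it uniform.
  cotorsion⇒annihilator : ∀ M → IsCotorsion M → ∃[ d ] (d ≉ 0# × Annihilator M d)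
  cotorsion⇒annihilator M cotorsion with cotorsion (1# , 0#) | cotorsion (0# , 1#)
  ... | r , r≉0 , re₁∈ | s , s≉0 , se₂∈ = r * s , *-≉0 r≉0 s≉0 , λ (x , y) →
    M.resp (first x y , second x y)
      (M.+-closed (M.*ₗ-closed (s * x) (-0-∈⁻¹ M re₁∈)) (M.*ₗ-closed (r * y) (-0-∈⁻¹ M se₂∈)))
    where
    module M = Submodule M
    first : ∀ x y → (s * x) * (r * 1#) + (r * y) * (s * 0#) ≈ (r * s) * x
    first x y = begin
      (s * x) * (r * 1#) + (r * y) * (s * 0#)  ≈⟨ +-cong (*-congˡ (*-identityʳ r)) (*-congˡ (zeroʳ s)) ⟩
      (s * x) * r + (r * y) * 0#               ≈⟨ +-congˡ (zeroʳ _) ⟩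
      (s * x) * r + 0#                         ≈⟨ +-identityʳ _ ⟩
      (s * x) * r                              ≈⟨ solve 3 (λ s x r → (s :* x) :* r := (r :* s) :* x) refl s x r ⟩
      (r * s) * x                              ∎
    second : ∀ x y → (s * x) * (r * 0#) + (r * y) * (s * 1#) ≈ (r * s) * y
    second x y = begin
      (s * x) * (r * 0#) + (r * y) * (s * 1#)  ≈⟨ +-cong (*-congˡ (zeroʳ r)) (*-congˡ (*-identityʳ s)) ⟩
      (s * x) * 0# + (r * y) * s               ≈⟨ +-congʳ (zeroʳ _) ⟩
      0# + (r * y) * s                         ≈⟨ +-identityˡ _ ⟩
      (r * y) * s                              ≈⟨ solve 3 (λ s y r → (r :* y) :* s := (r :* s) :* y) refl s y r ⟩
      (r * s) * y                              ∎

  annihilator⇒cotorsion : ∀ M {d} → d ≉ 0# → Annihilator M d → IsCotorsion M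
  annihilator⇒cotorsion M {d} d≉0 kills v = d , d≉0 , -0-∈ M (kills v)

  annihilator⇒rank-two : ∀ M {d} → d ≉ 0# → Annihilator M d → HasRank M 2
  annihilator⇒rank-two M {d} d≉0 kills = basis , basis∈M , independent , dependent
    where
    basis : Vector (Module.Carrierᴹ 𝓞²) 2
    basis = d *ₗ (1# , 0#) ∷ d *ₗ (0# , 1#) ∷ []

    basis∈M : ∀ i → basis i ∈ M
    basis∈M zero       = kills (1# , 0#)
    basis∈M (suc zero) = kills (0# , 1#)

    first : ∀ s t → s * (d * 1#) + (t * (d * 0#) + 0#) ≈ s * d
    first s t = begin
      s * (d * 1#) + (t * (d * 0#) + 0#)  ≈⟨ +-cong (*-congˡ (*-identityʳ d)) (trans (+-identityʳ _) (*-congˡ (zeroʳ d))) ⟩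
      s * d + t * 0#                      ≈⟨ trans (+-congˡ (zeroʳ t)) (+-identityʳ _) ⟩
      s * d                               ∎

    second : ∀ s t → s * (d * 0#) + (t * (d * 1#) + 0#) ≈ t * d
    second s t = begin
      s * (d * 0#) + (t * (d * 1#) + 0#)  ≈⟨ +-cong (*-congˡ (zeroʳ d)) (trans (+-identityʳ _) (*-congˡ (*-identityʳ d))) ⟩
      s * 0# + t * d                      ≈⟨ trans (+-congʳ (zeroʳ s)) (+-identityˡ _) ⟩
      t * d                               ∎

    divide : ∀ {s} → s * d ≈ 0# → s ≈ 0#
    divide eq = *-cancelʳ d≉0 (trans eq (sym (zeroˡ d)))

    independent : LinearlyIndependent {𝓞²} basis
    independent s (eq , eq′) zero       = divide (trans (sym (first _ _)) eq)
    independent s (eq , eq′) (suc zero) = divide (trans (sym (second _ _)) eq′)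

    dependent : ∀ x → x ∈ M → ¬ LinearlyIndependent {𝓞²} (x ∷ basis)
    -- The relation `d (x , y) - x (d , 0) - y (0 , d) = 0` has the nonzero coefficient `d`.
    dependent (x , y) _ indep = d≉0 (indep (d ∷ - x ∷ - y ∷ [])
      (trans (+-congˡ (first (- x) (- y))) (cancel x) , trans (+-congˡ (second (- x) (- y))) (cancel y)) zero)
      where
      cancel : ∀ z → d * z + - z * d ≈ 0#
      cancel z = trans (+-cong (*-comm d z) (sym (-‿distribˡ-* z d))) (-‿inverseʳ (z * d))

  ⋂-annihilator : ∀ {l} (M : Fin l → Submodule 𝓞²) → (∀ i → ∃[ d ] (d ≉ 0# × Annihilator (M i) d)) →
    ∃[ d ] (d ≉ 0# × Annihilator (⋂ M) d)
  ⋂-annihilator {zero}  M _ = 1# , proj₁ isIntegralDomain , λ _ ()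
  ⋂-annihilator {suc l} M f with f zero | ⋂-annihilator (M ∘ suc) (f ∘ suc)
  ... | d , d≉0 , kills | d′ , d′≉0 , kills′ = d * d′ , *-≉0 d≉0 d′≉0 , λ where
    v zero    → Submodule.resp (M zero) (Module.≈ᴹ-sym 𝓞² (Module.*ₗ-assoc 𝓞² d d′ v)) (kills (d′ *ₗ v))
    v (suc i) → Submodule.resp (M (suc i)) (Module.≈ᴹ-sym 𝓞² (Module.*ₗ-assoc 𝓞² d d′ v))
                  (Submodule.*ₗ-closed (M (suc i)) d (kills′ v i))

  -- `w` comes from the product of the factors other than `A j`; they are coprime to `P`, so it can
  -- be chosen outside `P`. At `P` the ideals `∏ A` and `A j` thus agree.
  localise : ∀ {n} (A : Fin n → Ideal) P → IsMaximal P → ∀ j → (∀ h → h ≢ j → Coprime (A h) P) →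
    ∃[ w ] (w ∉ P × (∀ {x} → x ∈ A j → w * x ∈ ∏ A))
  localise A P max zero f with coprime⇒∉ (proj₁ max) (coprime-sym (coprime-∏ {I = P} {A ∘ suc} (λ h → coprime-sym (f (suc h) λ ()))))
  ... | w , w∈ , w∉P = w , w∉P , λ {x} x∈ →
        Submodule.resp (∏ A) (*-comm x w) (·-intro {A zero} {∏ (A ∘ suc)} x∈ w∈)
  localise A P max (suc j) f
    with coprime⇒∉ (proj₁ max) (f zero λ ()) | localise (A ∘ suc) P max j (λ h h≢j → f (suc h) (h≢j ∘ Fin.suc-injective))
  ... | w₀ , w₀∈ , w₀∉P | w , w∉P , absorb = w₀ * w , (w∉P ∘ maximal-prime {P} max w₀∉P) , λ {x} x∈ →
        Submodule.resp (∏ A) (sym (*-assoc w₀ w x)) (·-intro {A zero} {∏ (A ∘ suc)} w₀∈ (absorb x∈))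

  module Structure {M : Submodule 𝓞²} (inv : Invariants M) (cotorsion : IsCotorsion M) where
    open Invariants inv
    open Inv inv

    -- A nonzero annihilator of `𝓞² / M` lies in `𝓚`, hence in `𝓜 j`, and starts the construction
    -- there.
    uniformizers : ∀ j → Σ[ u ∈ Uniformizer (𝓜 j) (maximal j) ] Uniformizer.p u ≉ 0#
    uniformizers j with cotorsion⇒annihilator M cotorsion
    ... | d , d≉0 , kills = u , p≉0 (𝓜 j) (maximal j) u d∈𝓜 d≉0
      where
      d∈𝓜 : d ∈ 𝓜 j
      d∈𝓜 = 𝓚⊆𝓜 j (kills⇒𝓚 {d} kills)

      u : Uniformizer (𝓜 j) (maximal j)
      u = uniformizer (𝓜 j) (maximal j) d∈𝓜 d≉0

    localise-^ : (e : Fin r → ℕ) → ∀ j →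
      ∃[ w ] (w ∉ 𝓜 j × (∀ {x} → x ∈ 𝓜 j ^ⁱ e j → w * x ∈ ∏ (λ h → 𝓜 h ^ⁱ e h)))
    localise-^ e j = localise (λ h → 𝓜 h ^ⁱ e h) (𝓜 j) (maximal j) j
      (λ h h≢j → coprime-sym (coprime-^ (e h) (coprime-sym (𝓜-pairwise h j h≢j))))

    -- At `𝓜 j`, test `x ∈ L` against the element `w p ^ (k j ∸ n j)` of `𝓘`, with `w` a local unit:
    -- the product lies in `𝓜 j ^ⁱ k j`, and cancelling `w` and the power of `p` leaves
    -- `x ∈ 𝓜 j ^ⁱ n j`.
    cancel-𝓘 : ∀ {L I K : Ideal} → L · I ⊆ K → K ⊆ 𝓚 → 𝓘 ⊆ I → L ⊆ 𝓛
    cancel-𝓘 {L} {I} {K} LI⊆K K⊆𝓚 𝓘⊆I {x} x∈L = ⋂⊆∏ (λ j → 𝓜 j ^ⁱ n j) (^-pairwise n) local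
      where
      local : ∀ j → x ∈ 𝓜 j ^ⁱ n j
      local j = uniformizer-cancel (𝓜 j) (maximal j) (proj₁ (uniformizers j)) (proj₂ (uniformizers j)) (n j) (k j ∸ n j)
        (unit-cancel (𝓜 j) (maximal j) (n j ℕ.+ (k j ∸ n j)) w∉P
          (≡.subst (λ e → w * (x * q) ∈ 𝓜 j ^ⁱ e) (≡.sym (ℕ.m+[n∸m]≡n (n≤k j))) (𝓚⊆ j wxq∈𝓚)))
        where
        open Uniformizer (proj₁ (uniformizers j))

        localised = localise-^ (λ h → k h ∸ n h) j
        w         = proj₁ localised
        w∉P       = proj₁ (proj₂ localised)
        q         = p ^ (k j ∸ n j)

        wq∈I : w * q ∈ I
        wq∈I = 𝓘⊆I (proj₂ (proj₂ localised) (^-mono-∈ {𝓜 j} (k j ∸ n j) p∈P))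

        wxq∈𝓚 : w * (x * q) ∈ 𝓚
        wxq∈𝓚 = Submodule.resp 𝓚 (x∙yz≈y∙xz x w q) (K⊆𝓚 (LI⊆K (·-intro {L} {I} x∈L wq∈I)))

    -- Take `w ∉ 𝓜 j` clearing the other primes. If `t` were in `𝓜 j ^ⁱ suc (n j)`, then
    -- `t w ∈ 𝓛 · 𝓜 j`; also `t q` is there for `q ∈ 𝓜 j`, and `1# = e w + q` combines the two.
    ∉-^suc : ∀ {t} → t ∈ 𝓛 → ∀ j → t ∉ 𝓛 · 𝓜 j → t ∉ 𝓜 j ^ⁱ suc (n j)
    ∉-^suc {t} t∈𝓛 j t∉ t∈ with localise-^ n j
    ... | w , w∉P , absorb with maximal-coprime {𝓜 j} (maximal j) {⟨ w ⟩} (1# , *-identityˡ w) w∉P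
    ...   | coprime (v , q , (e , ew≈v) , q∈ , eq) = t∉ (LP.resp (begin
        e * (t * w) + t * q  ≈⟨ solve 4 (λ e t w q → e :* (t :* w) :+ t :* q := t :* (e :* w :+ q)) refl e t w q ⟩
        t * (e * w + q)      ≈⟨ *-congˡ (+-congʳ ew≈v) ⟩
        t * (v + q)          ≈⟨ *-congˡ eq ⟨
        t * 1#               ≈⟨ *-identityʳ t ⟩
        t                    ∎) (LP.+-closed (LP.*ₗ-closed e tw∈) (·-intro {𝓛} {𝓜 j} t∈𝓛 q∈)))
      where
      module LP = Submodule (𝓛 · 𝓜 j)
      tw∈ : t * w ∈ 𝓛 · 𝓜 j
      tw∈ = ·-least {𝓜 j} {𝓜 j ^ⁱ n j} {(𝓛 · 𝓜 j) ∶ w} (λ {x} {y} x∈ y∈ →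
        LP.resp (solve 3 (λ w y x → (w :* y) :* x := (x :* y) :* w) refl w y x)
          (·-intro {𝓛} {𝓜 j} (absorb y∈) x∈)) t∈

    -- `D` consists of the `r` with `r x (a , b) ∈ M`. It contains `𝓚`, and at each `𝓜 j` it
    -- contains some `u ∉ 𝓜 j` with `t ∣ u * x`. So `D` is coprime to `𝓚` as well, which forces
    -- `1# ∈ D`.
    represents⇒𝓛 : ∀ {a b} → Represents inv a b → ∀ {x} → x ∈ 𝓛 → (x * a , x * b) ∈ M
    represents⇒𝓛 {a} {b} ρ {x} x∈𝓛 = Submodule.resp J (*-identityˡ x) 1∈D
      where
      open Represents ρ
      J D : Ideal
      J = M ∶ (a , b)
      D = J ∶ x

      local : ∀ j → Coprime D (𝓜 j)
      local j =
        let (u , u∉P , (q , qt≈ux)) = local-generator (𝓜 j) (maximal j) (proj₁ (uniformizers j)) (n j)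
                                        (𝓛⊆ j t∈𝓛) (∉-^suc t∈𝓛 j (t∉𝓛𝓜 j)) (𝓛⊆ j x∈𝓛)
        in maximal-coprime {𝓜 j} (maximal j) {D} {u} (Submodule.resp J qt≈ux (Submodule.*ₗ-closed J q ta,tb∈M)) u∉P

      1∈D : 1# ∈ D
      1∈D =
        let (y , z , y∈D , z∈𝓚 , eq) =
              Coprime.1∈I+J (coprime-∏ {I = D} {λ j → 𝓜 j ^ⁱ k j} (λ j → coprime-^ (k j) (local j)))
        in Submodule.resp D (sym eq) (Submodule.+-closed D {y} {z} y∈D (𝓚-kills (*ʳ-closed 𝓚 x z∈𝓚) (a , b)))

  -- Pairs in one class have their determinant in `𝓘`; multiplied by `t ∈ 𝓛` it lands in `𝓚`, which
  -- is what `change-representative` asks for. The same `t` therefore serves `q`.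
  invariant-representative : ∀ {M : Submodule 𝓞²} {I : Ideal} {p : Unimodular} (π : IsProjectiveInvariant M I p) {q : Unimodular} →
    Setoid._≈_ (PF¹ I) q p →
    Represents (IsProjectiveInvariant.invariants π) (Unimodular.fst q) (Unimodular.snd q)
  invariant-representative {M} {I} {p} π {q} q≈p = record
    { t       = t
    ; t∈𝓛     = t∈𝓛
    ; t∉𝓛𝓜    = t∉𝓛𝓜
    ; ta,tb∈M = change-representative invariants (Unimodular.unimodular representative)
        (Inv.𝓛𝓘⊆𝓚 invariants (·-intro {𝓛} {𝓘} t∈𝓛 (proj₁ I≐𝓘 q≈r))) ta,tb∈M
    }
    where
    open IsProjectiveInvariant π
    open Invariants invariants
    q≈r = Setoid.trans (PF¹ I) {q} {p} {representative} q≈p class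

-- Assembly for the given family.

module Intersections {c ℓ} (em : ExcludedMiddle (Level.suc (c ⊔ ℓ))) (𝓞 : CommutativeRing c ℓ)
  (dedekind : Over.IsDedekindDomain 𝓞) where

  open CommutativeRing 𝓞 using (Carrier; _≈_; _*_; 0#)
  open Over 𝓞
  open IdealTheory 𝓞
  open InvariantTheory 𝓞
  open IntersectionTheory em 𝓞 dedekind

  module FamilyOfSubmodules {l} (M : Fin l → Submodule 𝓞²) (L K I : Fin l → Ideal)
    (cotorsion : ∀ i → IsCotorsion (M i))
    (factors   : ∀ i → AreInvariantFactors (M i) (L i) (K i))
    (coprimes  : ∀ i j → i ≢ j → K i +ⁱ K j ≐ 𝟙)
    (K≐LI      : ∀ i → K i ≐ L i · I i)
    {aᵢbᵢ      : Fin l → Unimodular}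
    (classes   : ∀ i → IsProjectiveInvariant (M i) (I i) (aᵢbᵢ i))
    (ab        : Unimodular)
    (ab≈       : ∀ i → Setoid._≈_ (PF¹ (I i)) ab (aᵢbᵢ i)) where

    open Unimodular ab renaming (fst to a; snd to b)

    private
      α : ∀ i → Invariants (M i)
      α i = AreInvariantFactors.invariants (factors i)

      β : ∀ i → Invariants (M i)
      β i = IsProjectiveInvariant.invariants (classes i)

      -- The passage from one decomposition to the other: an element of `K i` annihilates `𝓞² / M i`
      -- by `α`, and annihilators lie in the `𝓚` of `β`.
      K⊆𝓚ᵝ : ∀ i → K i ⊆ Invariants.𝓚 (β i)
      K⊆𝓚ᵝ i x∈K = Inv.kills⇒𝓚 (β i) (Inv.𝓚-kills (α i) (proj₁ (AreInvariantFactors.K≐𝓚 (factors i)) x∈K))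

      L⊆𝓛ᵝ : ∀ i → L i ⊆ Invariants.𝓛 (β i)
      L⊆𝓛ᵝ i = Structure.cancel-𝓘 (β i) (cotorsion i) {L i} {I i} {K i} (proj₂ (K≐LI i)) (K⊆𝓚ᵝ i)
        (proj₂ (IsProjectiveInvariant.I≐𝓘 (classes i)))

      -- The intersection is decomposed twice: the version from `α` is compared with `L` and `K`,
      -- the version from `β` with `I` and the witnesses.
      module α⋂ = Intersection (intersection α (λ i j i≢j → coprime-mono {K i} {_} {K j}
        (proj₁ (AreInvariantFactors.K≐𝓚 (factors i))) (proj₁ (AreInvariantFactors.K≐𝓚 (factors j)))
        (coprime (proj₂ (coprimes i j i≢j) _))))

      module β⋂ = Intersection (intersection β (λ i j i≢j → coprime-mono {K i} {_} {K j}
        (K⊆𝓚ᵝ i) (K⊆𝓚ᵝ j) (coprime (proj₂ (coprimes i j i≢j) _))))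

      ρ : ∀ i → Represents (β i) a b
      ρ i = invariant-representative {M i} {I i} (classes i) {ab} (ab≈ i)

      ≐-∏ : ∀ (A B : Fin l → Ideal) {C : Ideal} → (∀ i → A i ≐ B i) → C ≐ ∏ B → ∏ A ≐ C
      ≐-∏ A B f (g , g′) = let (h , h′) = ∏-cong {A = A} {B} f in (λ p → g′ (h p)) , (λ p → h′ (g p))

      annihilator : ∃[ d ] (¬ (d ≈ 0#) × Annihilator (⋂ M) d)
      annihilator = ⋂-annihilator M (λ i → cotorsion⇒annihilator (M i) (cotorsion i))

    ⋂-cotorsion : IsCotorsion (⋂ M)
    ⋂-cotorsion = let (d , d≉0 , kills) = annihilator in annihilator⇒cotorsion (⋂ M) d≉0 kills

    ⋂-rank : HasRank (⋂ M) 2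
    ⋂-rank = let (d , d≉0 , kills) = annihilator in annihilator⇒rank-two (⋂ M) d≉0 kills

    ⋂-factors : AreInvariantFactors (⋂ M) (∏ L) (∏ K)
    ⋂-factors = record
      { invariants = α⋂.invariants
      ; L≐𝓛        = ≐-∏ L (λ i → Invariants.𝓛 (α i)) {Invariants.𝓛 α⋂.invariants} (λ i → AreInvariantFactors.L≐𝓛 (factors i)) α⋂.𝓛≐
      ; K≐𝓚        = ≐-∏ K (λ i → Invariants.𝓚 (α i)) {Invariants.𝓚 α⋂.invariants} (λ i → AreInvariantFactors.K≐𝓚 (factors i)) α⋂.𝓚≐
      }

    ∏K⊆∏L : ∏ K ⊆ ∏ L
    ∏K⊆∏L = ∏-mono (λ i p → ·⊆ˡ {L i} {I i} (proj₁ (K≐LI i) p))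

    ⋂-projective-invariant : IsProjectiveInvariant (⋂ M) (∏ I) ab
    ⋂-projective-invariant = record
      { invariants     = β⋂.invariants
      ; I≐𝓘            = ≐-∏ I (λ i → Invariants.𝓘 (β i)) {Invariants.𝓘 β⋂.invariants} (λ i → IsProjectiveInvariant.I≐𝓘 (classes i)) β⋂.𝓘≐
      ; representative = ab
      ; t              = t
      ; t∈𝓛            = t∈𝓛
      ; t∉𝓛𝓜           = t∉𝓛𝓜
      ; ta,tb∈M        = ta,tb∈M
      ; class          = Setoid.refl (PF¹ (∏ I)) {ab}
      }
      where open Represents (β⋂.represents ρ)

    ∏L-multiples∈⋂ : ∀ {t} → t ∈ ∏ L → (t * a , t * b) ∈ ⋂ M
    ∏L-multiples∈⋂ t∈ i = Structure.represents⇒𝓛 (β i) (cotorsion i) (ρ i) (L⊆𝓛ᵝ i (∏⊆ L i t∈))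

theorem5p3 :
  ∀ {c ℓ} → ExcludedMiddle (Level.suc (c ⊔ ℓ)) →
  (𝓞 : CommutativeRing c ℓ) →
  let open CommutativeRing 𝓞 using (Carrier)
      open CommutativeRing 𝓞 using (_*_)
      open Over 𝓞
  in
  IsDedekindDomain →
  {f : ℕ} (𝓕 : Fin f → Ideal) → (∀ m → IsMaximal (𝓕 m)) →
  {l : ℕ} (M : Fin l → Submodule 𝓞²) (L K I : Fin l → Ideal) →
  (∀ i → IsCotorsion (M i)) →
  (∀ i → HasRank (M i) 2) →
  (∀ i → AreInvariantFactors (M i) (L i) (K i)) →
  (∀ i j → i ≢ j → K i +ⁱ K j ≐ 𝟙) →
  (∀ i → K i ≐ L i · I i) →
  (∀ (P : Ideal) → IsMaximal P → ∀ i → K i ⊆ P → ∃[ m ] P ≐ 𝓕 m) →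
  (aᵢbᵢ : Fin l → Unimodular) →
  (∀ i → IsProjectiveInvariant (M i) (I i) (aᵢbᵢ i)) →
  (a b : Carrier) (ab : ⟨ a ⟩ +ⁱ ⟨ b ⟩ ≐ 𝟙) →
  (∀ i → Setoid._≈_ (PF¹ (I i)) (uni a b ab) (aᵢbᵢ i)) →
  (IsCotorsion (⋂ M) × HasRank (⋂ M) 2)
  × (AreInvariantFactors (⋂ M) (∏ L) (∏ K) × ∏ K ⊆ ∏ L)
  × IsProjectiveInvariant (⋂ M) (∏ I) (uni a b ab)
  × (∀ t → t ∈ ∏ L → (∀ m → t ∉ ∏ L · 𝓕 m) → (t * a , t * b) ∈ ⋂ M)
theorem5p3 em 𝓞 dedekind 𝓕 _ M L K I cotorsion _ factors coprimes K≐LI _ aᵢbᵢ classes a b ab ab≈ =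
  (⋂-cotorsion , ⋂-rank) , (⋂-factors , ∏K⊆∏L) , ⋂-projective-invariant , λ t t∈∏L _ → ∏L-multiples∈⋂ {t} t∈∏L
  where
  open Over 𝓞 using (uni)
  open Intersections em 𝓞 dedekind
  open FamilyOfSubmodules M L K I cotorsion factors coprimes K≐LI {aᵢbᵢ} classes (uni a b ab) ab≈
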